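{- Let $M=2s+2$ with $s\ge1$, $q$ a power of $2$. Let $K$ be a complete $k$-arc in $PG(2,q)$ with exactly one sum-point, such that $K\cap l_\infty=\{(0,0,1),(0,1,0)\}$, $(k-2)p(K)<q-1$, and $K\cap\{(1,a,Aa^2): A\in S_1(K), a\in\mathbb{F}_q\}=\emptyset$. For $j=0,\dots,s-1$ let $\Phi_j:PG(2j+2,q)\to PG(2s+2,q)$ be $\Phi_j(Y_0,\dots,Y_{2j+2})=(0,\dots,0,Y_0,Y_0,Y_1,\dots,Y_{2j+2})$ (with $2s-2j-1$ leading zeros), let $K^{(0)}=\Phi_0(K)$ and $K^{(j)}=\Phi_j((K:\mathcal{P}^j))$ for $1\le j\le s-1$. Then $$\mathcal{X}=(K:\mathcal{P}^s)\cup\bigcup_{j=0}^{s-1}K^{(j)}\subset PG(M,q)$$ is a complete cap of size $k\left(q^{\frac{M-2}{2}}+q^{\frac{M-4}{2}}+\dots+q+1\right)$.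
   Context: A cap in $PG(N,q)$ is a set of points no three collinear; complete if not contained in a larger cap; an arc is a cap in $PG(2,q)$. In $PG(2,q)$ with coordinates $(X_0,X_1,X_2)$, $l_\infty$ is the line $X_0=0$. A point is in normalized form if its first nonzero coordinate is $1$. Sum-point: for a complete arc $K$ and $Q\notin K$ in normalized form, for each secant $l$ (line meeting $K$ in two points) through $Q$ write $Q=c_1^{(l)}P_1+c_2^{(l)}P_2$ with $P_1,P_2$ the points of $l\cap K$ in normalized form; $Q$ is a sum-point if $c_1^{(l)}=c_2^{(l)}$ for all such $l$. If $K$ has exactly one sum-point, $p(K)$ is the number of secants of $K$ through it. $S_1(K)=\{X_1+Y_1:(X_0,X_1,X_2),(Y_0,Y_1,Y_2)\in K$ in normalized form, $X_0=Y_0$, $X_1\ne Y_1$, $X_2+Y_2=X_1+Y_1\}$. $\mathcal{P}^j=\{(a_1,a_1^2,\dots,a_j,a_j^2):a_i\in\mathbb{F}_q\}\subset\mathbb{F}_q^{2j}$. For points $C\subset PG(n,q)$ and $C'\subset\mathbb{F}_q^m$, $(C:C')=\{(x_0,\dots,x_n,y_1,\dots,y_m):(x_0,\dots,x_n)$ normalized form of a point of $C$, $(y_i)\in C'\}\subset PG(n+m,q)$. -}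

module Defs where

open import Level using (0ℓ)
open import Data.Nat as ℕ using (ℕ; zero; suc)
open import Data.Fin using (Fin)
open import Data.List using (List; []; _∷_; length; replicate; _++_)
open import Data.List.Membership.Propositional using (_∈_)
open import Data.List.Relation.Unary.Unique.Propositional using (Unique)
open import Data.Vec as V using (Vec; []; _∷_; toList; head)
open import Data.Product using (Σ; ∃; ∃-syntax; _×_; _,_)
open import Data.Sum using (_⊎_)
open import Relation.Nullary using (¬_; Dec)
open import Relation.Binary.PropositionalEquality using (_≡_; _≢_)
open import Algebra.Structures using (IsCommutativeRing)
open import Function.Bundles using (_⇔_)

record FiniteField : Set₁ where
  field
    Carrier : Set
    _+_ _*_ : Carrier → Carrier → Carrier
    -_      : Carrier → Carrier
    0# 1#   : Carrier
    isCommutativeRing : IsCommutativeRing _≡_ _+_ _*_ -_ 0# 1#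
    _⁻¹     : Carrier → Carrier
    ⁻¹-inverse : ∀ x → x ≢ 0# → (x * (x ⁻¹)) ≡ 1#
    0≢1     : 0# ≢ 1#
    _≟_     : (x y : Carrier) → Dec (x ≡ y)
    elements : List Carrier
    elements-unique : Unique elements
    elements-complete : ∀ x → x ∈ elements
  infixl 6 _+_
  infixl 7 _*_

  order : ℕ
  order = length elements

HasSize : {A : Set} → (A → Set) → ℕ → Set
HasSize {A} P m =
  Σ (List A) λ xs → Unique xs × (∀ x → (x ∈ xs) ⇔ P x) × length xs ≡ m

geomSum : ℕ → ℕ → ℕ
geomSum q zero    = 1
geomSum q (suc n) = q ℕ.^ suc n ℕ.+ geomSum q n

module Geometry (F : FiniteField) where
  open FiniteField F

  -- A point of PG(N,q) is represented by its normalized coordinate vector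
  -- (X_0,...,X_N) ∈ F^(N+1): first nonzero coordinate equal to 1.
  Normalized : ∀ {n} → Vec Carrier n → Set
  Normalized []       = ⊥'
    where open import Data.Empty using () renaming (⊥ to ⊥')
  Normalized (x ∷ xs) = (x ≡ 1#) ⊎ ((x ≡ 0#) × Normalized xs)

  _·_ : Carrier → ∀ {n} → Vec Carrier n → Vec Carrier n
  c · v = V.map (c *_) v

  _⊕_ : ∀ {n} → Vec Carrier n → Vec Carrier n → Vec Carrier n
  _⊕_ = V.zipWith _+_

  zeroV : ∀ {n} → Vec Carrier n
  zeroV = V.replicate _ 0#

  dot : ∀ {n} → Vec Carrier n → Vec Carrier n → Carrier
  dot u v = V.foldr _ _+_ 0# (V.zipWith _*_ u v)

  Collinear : ∀ {n} → Vec Carrier n → Vec Carrier n → Vec Carrier n → Set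
  Collinear x y z = ∃[ a ] ∃[ b ] ∃[ c ]
    (¬ (a ≡ 0# × b ≡ 0# × c ≡ 0#)) × ((a · x) ⊕ ((b · y) ⊕ (c · z))) ≡ zeroV

  -- point sets in PG(N,q) are predicates on normalized vectors of length N+1
  PointSet : ℕ → Set₁
  PointSet N = Vec Carrier (suc N) → Set

  IsCap : ∀ {N} → PointSet N → Set
  IsCap {N} S =
    (∀ x → S x → Normalized x) ×
    (∀ x y z → S x → S y → S z → x ≢ y → y ≢ z → x ≢ z → ¬ Collinear x y z)

  IsCompleteCap : ∀ {N} → PointSet N → Set
  IsCompleteCap {N} S =
    IsCap S × (∀ P → Normalized P → ¬ S P → ¬ IsCap (λ x → S x ⊎ x ≡ P))

  IsCompleteArc : PointSet 2 → ℕ → Set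
  IsCompleteArc K k = IsCompleteCap K × HasSize K k

  IsSumPoint : PointSet 2 → Vec Carrier 3 → Set
  IsSumPoint K Q =
    Normalized Q × ¬ K Q ×
    (∀ P₁ P₂ c₁ c₂ → K P₁ → K P₂ → P₁ ≢ P₂ →
       Q ≡ ((c₁ · P₁) ⊕ (c₂ · P₂)) → c₁ ≡ c₂)

  -- lines of PG(2,q) given by normalized dual coordinates u: points x with u·x = 0
  OnLine : Vec Carrier 3 → Vec Carrier 3 → Set
  OnLine u x = dot u x ≡ 0#

  IsSecant : PointSet 2 → Vec Carrier 3 → Set
  IsSecant K u = Normalized u × HasSize (λ x → K x × OnLine u x) 2

  NumSecantsThrough : PointSet 2 → Vec Carrier 3 → ℕ → Set
  NumSecantsThrough K Q p = HasSize (λ u → IsSecant K u × OnLine u Q) p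

  UniqueSumPointWith : PointSet 2 → ℕ → Set
  UniqueSumPointWith K p = ∃[ Q ] IsSumPoint K Q ×
    (∀ Q' → IsSumPoint K Q' → Q' ≡ Q) × NumSecantsThrough K Q p

  S₁ : PointSet 2 → Carrier → Set
  S₁ K A = ∃[ X₀ ] ∃[ X₁ ] ∃[ X₂ ] ∃[ Y₁ ] ∃[ Y₂ ]
    K (X₀ ∷ X₁ ∷ X₂ ∷ []) × K (X₀ ∷ Y₁ ∷ Y₂ ∷ []) × X₁ ≢ Y₁ ×
    (X₂ + Y₂) ≡ (X₁ + Y₁) × A ≡ (X₁ + Y₁)

  𝒫 : (j : ℕ) → Vec Carrier (j ℕ.+ j) → Set
  𝒫 j y = ∃[ a ] toList y ≡ squares j a
    where
    squares : (j : ℕ) → Vec Carrier j → List Carrier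
    squares zero    []       = []
    squares (suc j) (a ∷ as) = a ∷ (a * a) ∷ squares j as

  Join : ∀ {n m} → PointSet n → (Vec Carrier m → Set) → PointSet (n ℕ.+ m)
  Join {n} {m} C C' v = ∃[ x ] ∃[ y ] Normalized x × C x × C' y × toList v ≡ toList x ++ toList y

  e₁ e₂ : Vec Carrier 3
  e₁ = 0# ∷ 1# ∷ 0# ∷ []
  e₂ = 0# ∷ 0# ∷ 1# ∷ []

  -- K^(j) = Φ_j((K : P^j)) ⊂ PG(2s+2,q), 0 ≤ j ≤ s-1  (with (K:P^0) = K)
  Kj : PointSet 2 → (s j : ℕ) → PointSet (2 ℕ.+ (s ℕ.+ s))
  Kj K s j v = ∃[ Y₀ ] ∃[ Y ] Join K (𝒫 j) (Y₀ ∷ Y) ×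
    toList v ≡ replicate ((s ℕ.+ s) ℕ.∸ (j ℕ.+ j) ℕ.∸ 1) 0# ++ (Y₀ ∷ Y₀ ∷ toList Y)

  𝒳 : PointSet 2 → (s : ℕ) → PointSet (2 ℕ.+ (s ℕ.+ s))
  𝒳 K s v = Join K (𝒫 s) v ⊎ (∃[ j ] (j ℕ.< s) × Kj K s j v)

{-# OPTIONS --safe #-}
-- Let D(u₀, u₁, …) = (0, u₀, u₀, u₁, …). Then 𝒳 K 0 = K and 𝒳 K (s+1) = (K : 𝒫^(s+1)) ∪ D(𝒳 K s),
-- and everything goes by induction on s.
--
-- Cap: a dependent triple inside (K : 𝒫^s) projects to a triple of K, hence to a single point, and
-- then its paraboloid parts agree by the arc property of the conics (1, a, a²). A point of D(𝒳)
-- on a secant of (K : 𝒫^s) is D of a multiple of (A, γ₁, γ₁², γ₂, γ₂², …) with A = 0 or A ∈ S₁(K);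
-- no such point lies in 𝒳, because K misses the points (1, a, Aa²).
--
-- Completeness: in characteristic 2 the point (0, 1, 1) is always a sum-point, hence the only one.
-- Write P = (x, v) with x in the plane. If x ∉ K is not a sum-point, it lies on a secant
-- x = c₁y + c₂z with c₁ ≠ c₂, and c₁(α, α²) + c₂(β, β²) takes all values. If x ∈ K, use
-- x = cx + (c+1)x with c ≠ 0, 1 in the same way. If x = (0, 1, 1) or x = 0, then P lies in the
-- image of D.
module Submission where

open import Defs
open import Level using (0ℓ)
open import Data.Bool using (true; false)
import Data.Bool.Properties as Bool
open import Data.Empty using (⊥)
open import Data.Unit using (⊤; tt)
open import Data.Nat as ℕ using (ℕ; zero; suc; _∸_; _<_; _≤_; _^_; z≤n; s≤s)
import Data.Nat.Properties as ℕ
open import Data.Nat.Solver using (module +-*-Solver)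
open import Data.List as List using (List; []; _∷_; length; map; foldr; cartesianProductWith)
import Data.List.Properties as List
open import Data.List.Membership.Propositional using (_∈_)
open import Data.List.Membership.Propositional.Properties
open import Data.List.Membership.Propositional.Properties.WithK using (unique∧set⇒bag)
import Data.List.Membership.DecPropositional as DecMembership
open import Data.List.Relation.Binary.BagAndSetEquality using (∼bag⇒↭)
open import Data.List.Relation.Binary.Permutation.Propositional as Perm using (_↭_)
open import Data.List.Relation.Binary.Subset.Propositional using (_⊆_)
open import Data.List.Relation.Unary.All as All using (All; []; _∷_)
open import Data.List.Relation.Unary.Any using (here; there)
open import Data.List.Relation.Unary.Unique.Propositional using (Unique; []; _∷_)
import Data.List.Relation.Unary.Unique.Propositional.Properties as Unique
open import Data.Maybe using (just; nothing)
open import Data.Product using (∃-syntax; _×_; _,_; proj₁; proj₂)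
open import Data.Sum using (_⊎_; inj₁; inj₂; [_,_]′)
open import Data.Vec as Vec using (Vec; []; _∷_; head; toList; _++_)
import Data.Vec.Properties as Vec
open import Data.Vec.Properties using (∷-injectiveˡ; ∷-injectiveʳ)
open import Function using (_∘_; _⇔_; mk⇔)
open import Function.Bundles using (Equivalence)
open import Algebra.Bundles using (CommutativeRing)
import Algebra.Properties.Ring as RingProperties
import Algebra.Properties.Semiring.Mult as Mult
open import Algebra.Solver.Ring.AlmostCommutativeRing
  using (fromCommutativeRing; _-Raw-AlmostCommutative⟶_; Induced-equivalence)
import Algebra.Solver.Ring as RingSolver
open import Relation.Nullary using (¬_; Dec; yes; no; contradiction)
open import Relation.Binary.Definitions using (WeaklyDecidable)
open import Relation.Binary.PropositionalEquality

-- Counting with duplicate-free lists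

unique-⊆⇒length-≤ : ∀ {A : Set} {xs ys : List A} → Unique xs → xs ⊆ ys → length xs ≤ length ys
unique-⊆⇒length-≤ [] _ = z≤n
unique-⊆⇒length-≤ {xs = x ∷ xs} (x∉xs ∷ xs!) xs⊆ys with ∈-∃++ (xs⊆ys (here refl))
... | as , bs , refl = subst (suc (length xs) ≤_) (sym (List.length-++-sucʳ as x bs))
        (s≤s (unique-⊆⇒length-≤ xs! rest))
  where
  rest : xs ⊆ as List.++ bs
  rest {z} z∈xs with ∈-++⁻ as (xs⊆ys (there z∈xs))
  ... | inj₁ z∈as         = ∈-++⁺ˡ z∈as
  ... | inj₂ (here refl)  = contradiction refl (All.lookup x∉xs z∈xs)
  ... | inj₂ (there z∈bs) = ∈-++⁺ʳ as z∈bs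

length-cartesianProductWith : ∀ {A B C : Set} (f : A → B → C) xs ys →
  length (cartesianProductWith f xs ys) ≡ length xs ℕ.* length ys
length-cartesianProductWith f []       ys = refl
length-cartesianProductWith f (x ∷ xs) ys = trans (List.length-++ (map (f x) ys))
  (cong₂ ℕ._+_ (List.length-map (f x) ys) (length-cartesianProductWith f xs ys))

module _ {A : Set} where

  size-resp-⇔ : ∀ {P Q : A → Set} {m} → (∀ x → P x ⇔ Q x) → HasSize P m → HasSize Q m
  size-resp-⇔ P⇔Q (xs , xs! , xs⇔P , len) = xs , xs! ,
    (λ x → mk⇔ (Equivalence.to (P⇔Q x) ∘ Equivalence.to (xs⇔P x))
               (Equivalence.from (xs⇔P x) ∘ Equivalence.from (P⇔Q x))) , len

  size-⊎ : ∀ {P Q : A → Set} {m n} → (∀ x → P x → ¬ Q x) →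
    HasSize P m → HasSize Q n → HasSize (λ x → P x ⊎ Q x) (m ℕ.+ n)
  size-⊎ {P} {Q} P#Q (xs , xs! , xs⇔P , refl) (ys , ys! , ys⇔Q , refl) =
    xs List.++ ys ,
    Unique.++⁺ xs! ys! (λ {x} (x∈xs , x∈ys) → P#Q x (to (xs⇔P x) x∈xs) (to (ys⇔Q x) x∈ys)) ,
    (λ x → mk⇔ (⇒ x) [ ∈-++⁺ˡ ∘ from (xs⇔P x) , ∈-++⁺ʳ xs ∘ from (ys⇔Q x) ]′) ,
    List.length-++ xs
    where
    open Equivalence
    ⇒ : ∀ x → x ∈ xs List.++ ys → P x ⊎ Q x
    ⇒ x x∈ with ∈-++⁻ xs x∈
    ... | inj₁ x∈xs = inj₁ (to (xs⇔P x) x∈xs)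
    ... | inj₂ x∈ys = inj₂ (to (ys⇔Q x) x∈ys)

  size-lower : ∀ {P : A → Set} {m} → HasSize P m → ∀ {xs} → Unique xs → All P xs → length xs ≤ m
  size-lower (ys , _ , ys⇔P , refl) xs! all =
    unique-⊆⇒length-≤ xs! (λ {x} x∈xs → Equivalence.from (ys⇔P x) (All.lookup all x∈xs))

size-image : ∀ {A B : Set} {P : A → Set} {m} (f : A → B) → (∀ {x y} → f x ≡ f y → x ≡ y) →
  HasSize P m → HasSize (λ y → ∃[ x ] P x × y ≡ f x) m
size-image f f-inj (xs , xs! , xs⇔P , refl) =
  map f xs , Unique.map⁺ f-inj xs! ,
  (λ y → mk⇔ (λ y∈ → let x , x∈xs , eq = ∈-map⁻ f y∈ in x , Equivalence.to (xs⇔P x) x∈xs , eq)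
             (λ { (x , Px , refl) → ∈-map⁺ f (Equivalence.from (xs⇔P x) Px) })) ,
  List.length-map f xs

size-image₂ : ∀ {A B C : Set} {P : A → Set} {Q : B → Set} {m n} (f : A → B → C) →
  (∀ {w x y z} → f w y ≡ f x z → w ≡ x × y ≡ z) →
  HasSize P m → HasSize Q n → HasSize (λ z → ∃[ x ] ∃[ y ] P x × Q y × z ≡ f x y) (m ℕ.* n)
size-image₂ f f-inj (xs , xs! , xs⇔P , refl) (ys , ys! , ys⇔Q , refl) =
  cartesianProductWith f xs ys , Unique.cartesianProductWith⁺ f f-inj xs! ys! ,
  (λ z → mk⇔
    (λ z∈ → let x , y , x∈xs , y∈ys , eq = ∈-cartesianProductWith⁻ f xs ys z∈
            in x , y , to (xs⇔P x) x∈xs , to (ys⇔Q y) y∈ys , eq)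
    (λ { (x , y , Px , Qy , refl) →
           ∈-cartesianProductWith⁺ f (from (xs⇔P x) Px) (from (ys⇔Q y) Qy) })) ,
  length-cartesianProductWith f xs ys
  where open Equivalence

-- Finite fields: an order that is a power of 2 forces characteristic 2

module FieldProperties (F : FiniteField) where
  open FiniteField F public

  commutativeRing : CommutativeRing 0ℓ 0ℓ
  commutativeRing = record { isCommutativeRing = isCommutativeRing }

  open CommutativeRing commutativeRing public
    using (+-comm; +-assoc; +-identityˡ; +-identityʳ; -‿inverseˡ; -‿inverseʳ; *-comm; *-assoc;
           *-identityˡ; *-identityʳ; zeroˡ; zeroʳ; distribˡ; distribʳ; semiring; ring)
  open Mult semiring using () renaming (_×_ to _⊠_; ×1-homo-* to ⊠1-homo-*)
  open RingProperties ring using (+-cancelˡ; +-cancelʳ)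

  x*y≡0⇒y≡0 : ∀ {x y} → x ≢ 0# → x * y ≡ 0# → y ≡ 0#
  x*y≡0⇒y≡0 {x} {y} x≢0 xy≡0 = begin
    y                ≡⟨ *-identityˡ y ⟨
    1# * y           ≡⟨ cong (_* y) (⁻¹-inverse x x≢0) ⟨
    x * x ⁻¹ * y     ≡⟨ cong (_* y) (*-comm x (x ⁻¹)) ⟩
    x ⁻¹ * x * y     ≡⟨ *-assoc (x ⁻¹) x y ⟩
    x ⁻¹ * (x * y)   ≡⟨ cong (x ⁻¹ *_) xy≡0 ⟩
    x ⁻¹ * 0#        ≡⟨ zeroʳ (x ⁻¹) ⟩
    0#               ∎
    where open ≡-Reasoning

  total : List Carrier → Carrier
  total = foldr _+_ 0#

  total-↭ : ∀ {xs ys} → xs ↭ ys → total xs ≡ total ys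
  total-↭ Perm.refl          = refl
  total-↭ (Perm.prep x p)    = cong (x +_) (total-↭ p)
  total-↭ (Perm.swap {xs} {ys} x y p) = begin
    x + (y + total xs)   ≡⟨ +-assoc x y (total xs) ⟨
    x + y + total xs     ≡⟨ cong₂ _+_ (+-comm x y) (total-↭ p) ⟩
    y + x + total ys     ≡⟨ +-assoc y x (total ys) ⟩
    y + (x + total ys)   ∎
    where open ≡-Reasoning
  total-↭ (Perm.trans p q)   = trans (total-↭ p) (total-↭ q)

  total-map-1+ : ∀ xs → total (map (1# +_) xs) ≡ length xs ⊠ 1# + total xs
  total-map-1+ []       = sym (+-identityʳ 0#)
  total-map-1+ (x ∷ xs) = begin
    1# + x + total (map (1# +_) xs)   ≡⟨ cong (1# + x +_) (total-map-1+ xs) ⟩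
    1# + x + (n1 + total xs)          ≡⟨ +-assoc 1# x _ ⟩
    1# + (x + (n1 + total xs))        ≡⟨ cong (1# +_) (+-assoc x n1 _) ⟨
    1# + (x + n1 + total xs)          ≡⟨ cong (λ z → 1# + (z + total xs)) (+-comm x n1) ⟩
    1# + (n1 + x + total xs)          ≡⟨ cong (1# +_) (+-assoc n1 x _) ⟩
    1# + (n1 + (x + total xs))        ≡⟨ +-assoc 1# n1 _ ⟨
    1# + n1 + (x + total xs)          ∎
    where
    open ≡-Reasoning
    n1 = length xs ⊠ 1#

  -- Translation by 1 permutes the field, so it does not change the sum of all elements.
  order⊠1≡0 : order ⊠ 1# ≡ 0#
  order⊠1≡0 = +-cancelʳ (total elements) _ _
    (trans (sym (total-map-1+ elements)) (trans (total-↭ shifted) (sym (+-identityˡ _))))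
    where
    shifted : map (1# +_) elements ↭ elements
    shifted = ∼bag⇒↭ (unique∧set⇒bag (Unique.map⁺ (+-cancelˡ 1# _ _) elements-unique) elements-unique
      (λ {x} → mk⇔ (λ _ → elements-complete x)
        (λ _ → subst (_∈ map (1# +_) elements) (1+[-1+x] x) (∈-map⁺ (1# +_) (elements-complete (- 1# + x))))))
      where
      1+[-1+x] : ∀ x → 1# + (- 1# + x) ≡ x
      1+[-1+x] x = trans (sym (+-assoc 1# (- 1#) x))
                   (trans (cong (_+ x) (-‿inverseʳ 1#)) (+-identityˡ x))

  -- The 2 ^ e-fold sum of 1 is the `e`-th power of `1# + 1#`, and a field has no zero divisors. For
  -- `e` = 0 the hypothesis would read 1 = 0.
  order≡2^e⇒1+1≡0 : ∀ e → order ≡ 2 ^ e → 1# + 1# ≡ 0#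
  order≡2^e⇒1+1≡0 e order≡2^e = root e (trans (cong (_⊠ 1#) (sym order≡2^e)) order⊠1≡0)
    where
    root : ∀ e → (2 ^ e) ⊠ 1# ≡ 0# → 1# + 1# ≡ 0#
    root zero    eq = contradiction (trans (sym eq) (+-identityʳ 1#)) 0≢1
    root (suc e) eq with (1# + 1#) ≟ 0#
    ... | yes 2≡0 = 2≡0
    ... | no  2≢0 = root e (x*y≡0⇒y≡0 2≢0
      (trans (cong (_* ((2 ^ e) ⊠ 1#)) (cong (1# +_) (sym (+-identityʳ 1#))))
             (trans (sym (⊠1-homo-* 2 (2 ^ e))) eq)))

-- Arithmetic in characteristic 2: square roots and the weighted system

CharacteristicTwo : FiniteField → Set
CharacteristicTwo F = 1# + 1# ≡ 0#
  where open FiniteField F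

module CharacteristicTwoProperties (F : FiniteField) (1+1≡0 : CharacteristicTwo F) where
  open FieldProperties F public

  x+x≡0 : ∀ x → x + x ≡ 0#
  x+x≡0 x = begin
    x + x             ≡⟨ cong₂ _+_ (*-identityˡ x) (*-identityˡ x) ⟨
    1# * x + 1# * x   ≡⟨ distribʳ x 1# 1# ⟨
    (1# + 1#) * x     ≡⟨ cong (_* x) 1+1≡0 ⟩
    0# * x            ≡⟨ zeroˡ x ⟩
    0#                ∎
    where open ≡-Reasoning

  -x≡x : ∀ x → - x ≡ x
  -x≡x x = begin
    - x               ≡⟨ +-identityʳ (- x) ⟨
    - x + 0#          ≡⟨ cong (- x +_) (x+x≡0 x) ⟨
    - x + (x + x)     ≡⟨ +-assoc (- x) x x ⟨
    - x + x + x       ≡⟨ cong (_+ x) (-‿inverseˡ x) ⟩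
    0# + x            ≡⟨ +-identityˡ x ⟩
    x                 ∎
    where open ≡-Reasoning

  -- With coefficients in 𝔽₂ the solver knows that x + x ≡ 0.
  private
    𝔽₂→F : CommutativeRing.rawRing Bool.xor-∧-commutativeRing -Raw-AlmostCommutative⟶ fromCommutativeRing commutativeRing
    𝔽₂→F = record
      { ⟦_⟧    = λ { false → 0# ; true → 1# }
      ; +-homo = λ { false false → sym (+-identityˡ 0#) ; false true → sym (+-identityˡ 1#)
                   ; true false → sym (+-identityʳ 1#) ; true true → sym 1+1≡0 }
      ; *-homo = λ { false y → sym (zeroˡ _) ; true y → sym (*-identityˡ _) }
      ; -‿homo = λ x → sym (-x≡x _)
      ; 0-homo = refl
      ; 1-homo = refl
      }
    _𝔽₂≟_ : WeaklyDecidable (Induced-equivalence 𝔽₂→F)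
    false 𝔽₂≟ false = just refl
    true  𝔽₂≟ true  = just refl
    _     𝔽₂≟ _     = nothing

    module Solver = RingSolver _ (fromCommutativeRing commutativeRing) 𝔽₂→F _𝔽₂≟_
  open Solver public using (solve; _:+_; _:*_; _:=_; con)

  x+y≡0⇒x≡y : ∀ {x y} → x + y ≡ 0# → x ≡ y
  x+y≡0⇒x≡y {x} {y} eq = begin
    x             ≡⟨ solve 2 (λ x y → x := x :+ y :+ y) refl x y ⟩
    x + y + y     ≡⟨ cong (_+ y) eq ⟩
    0# + y        ≡⟨ +-identityˡ y ⟩
    y             ∎
    where open ≡-Reasoning

  x≡y⇒x+y≡0 : ∀ {x y} → x ≡ y → x + y ≡ 0#
  x≡y⇒x+y≡0 {x} refl = x+x≡0 x

  *-cancelˡ-nonZero : ∀ {x y z} → x ≢ 0# → x * y ≡ x * z → y ≡ z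
  *-cancelˡ-nonZero {x} {y} {z} x≢0 eq =
    x+y≡0⇒x≡y (x*y≡0⇒y≡0 x≢0 (trans (distribˡ x y z) (x≡y⇒x+y≡0 eq)))

  x*x≡0⇒x≡0 : ∀ {x} → x * x ≡ 0# → x ≡ 0#
  x*x≡0⇒x≡0 {x} eq with x ≟ 0#
  ... | yes x≡0 = x≡0
  ... | no  x≢0 = x*y≡0⇒y≡0 x≢0 eq

  square-injective : ∀ {x y} → x * x ≡ y * y → x ≡ y
  square-injective {x} {y} eq = x+y≡0⇒x≡y (x*x≡0⇒x≡0
    (trans (solve 2 (λ x y → (x :+ y) :* (x :+ y) := x :* x :+ y :* y) refl x y) (x≡y⇒x+y≡0 eq)))

  -- Squaring is injective on a finite set, hence surjective: a non-square added to the list of all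
  -- squares would give more than `order` distinct elements.
  squareRoot : ∀ x → ∃[ r ] r * r ≡ x
  squareRoot x with DecMembership._∈?_ _≟_ x (map (λ r → r * r) elements)
  ... | yes x∈squares with ∈-map⁻ (λ r → r * r) x∈squares
  ...   | r , _ , x≡r² = r , sym x≡r²
  squareRoot x | no x∉squares = contradiction
    (subst (λ n → suc n ≤ order) (List.length-map (λ r → r * r) elements)
      (unique-⊆⇒length-≤
        (All.tabulate (λ { y∈ refl → x∉squares y∈ }) ∷ Unique.map⁺ square-injective elements-unique)
        (λ {y} _ → elements-complete y)))
    ℕ.1+n≰n

  -- Taking the square root of the second equation turns the system into a linear one of
  -- determinant √(c₁c₂) (√c₁ + √c₂).
  solvePair : ∀ {c₁ c₂} → c₁ ≢ 0# → c₂ ≢ 0# → c₁ ≢ c₂ → ∀ m n →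
    ∃[ α ] ∃[ β ] m ≡ c₁ * α + c₂ * β × n ≡ c₁ * (α * α) + c₂ * (β * β)
  solvePair {c₁} {c₂} c₁≢0 c₂≢0 c₁≢c₂ m n
    with squareRoot c₁ | squareRoot c₂ | squareRoot n
  ... | r , refl | t , refl | ν , refl = α , β , first , second
    where
    open ≡-Reasoning
    r≢0 : r ≢ 0#
    r≢0 refl = c₁≢0 (zeroˡ 0#)
    t≢0 : t ≢ 0#
    t≢0 refl = c₂≢0 (zeroˡ 0#)
    t+r≢0 : t + r ≢ 0#
    t+r≢0 eq with refl ← x+y≡0⇒x≡y eq = c₁≢c₂ refl
    -- Substituting `r * α` = `ν + t * β` into `r * (r * α) + t * (t * β)` = `m` leaves
    -- `(t + r) * (t * β)` = `m + r * ν`.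
    β = t ⁻¹ * ((t + r) ⁻¹ * (m + r * ν))
    α = r ⁻¹ * (ν + t * β)

    cancel : ∀ {x} y → x ≢ 0# → x * (x ⁻¹ * y) ≡ y
    cancel {x} y x≢0 = trans (sym (*-assoc x (x ⁻¹) y))
      (trans (cong (_* y) (⁻¹-inverse x x≢0)) (*-identityˡ y))

    rα : r * α ≡ ν + t * β
    rα = cancel (ν + t * β) r≢0
    tβ : (t + r) * (t * β) ≡ m + r * ν
    tβ = trans (cong ((t + r) *_) (cancel _ t≢0)) (cancel _ t+r≢0)

    first : m ≡ r * r * α + t * t * β
    first = begin
      m
        ≡⟨ solve 2 (λ m rν → m := m :+ rν :+ rν) refl m (r * ν) ⟩
      m + r * ν + r * ν
        ≡⟨ cong (_+ r * ν) tβ ⟨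
      (t + r) * (t * β) + r * ν
        ≡⟨ solve 4 (λ t r β ν → (t :+ r) :* (t :* β) :+ r :* ν := r :* (ν :+ t :* β) :+ t :* t :* β)
             refl t r β ν ⟩
      r * (ν + t * β) + t * t * β
        ≡⟨ cong (λ z → r * z + t * t * β) rα ⟨
      r * (r * α) + t * t * β
        ≡⟨ cong (_+ t * t * β) (*-assoc r r α) ⟨
      r * r * α + t * t * β ∎

    second : ν * ν ≡ r * r * (α * α) + t * t * (β * β)
    second = begin
      ν * ν
        ≡⟨ solve 2 (λ ν tβ → ν :* ν := (ν :+ tβ) :* (ν :+ tβ) :+ tβ :* tβ) refl ν (t * β) ⟩
      (ν + t * β) * (ν + t * β) + t * β * (t * β)
        ≡⟨ cong (λ z → z * z + t * β * (t * β)) rα ⟨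
      r * α * (r * α) + t * β * (t * β)
        ≡⟨ solve 4 (λ r α t β → r :* α :* (r :* α) :+ t :* β :* (t :* β)
                             := r :* r :* (α :* α) :+ t :* t :* (β :* β)) refl r α t β ⟩
      r * r * (α * α) + t * t * (β * β) ∎

-- Normalized vectors, collinearity and caps

module VectorProperties (F : FiniteField) (1+1≡0 : CharacteristicTwo F) where
  open CharacteristicTwoProperties F 1+1≡0 public
  open Geometry F public


  ⊕-rotate : ∀ {n} (x y z : Vec Carrier n) → x ⊕ (y ⊕ z) ≡ y ⊕ (z ⊕ x)
  ⊕-rotate []       []       []       = refl
  ⊕-rotate (x ∷ xs) (y ∷ ys) (z ∷ zs) = cong₂ _∷_
    (solve 3 (λ x y z → x :+ (y :+ z) := y :+ (z :+ x)) refl x y z) (⊕-rotate xs ys zs)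

  ⊕-comm : ∀ {n} (x y : Vec Carrier n) → x ⊕ y ≡ y ⊕ x
  ⊕-comm = Vec.zipWith-comm +-comm

  0·x⊕y≡y : ∀ {n} (x y : Vec Carrier n) → (0# · x) ⊕ y ≡ y
  0·x⊕y≡y []       []       = refl
  0·x⊕y≡y (x ∷ xs) (y ∷ ys) = cong₂ _∷_
    (solve 2 (λ x y → con false :* x :+ y := y) refl x y) (0·x⊕y≡y xs ys)

  ·-distribʳ-+ : ∀ {n} a b (x : Vec Carrier n) → (a · x) ⊕ (b · x) ≡ (a + b) · x
  ·-distribʳ-+ a b []       = refl
  ·-distribʳ-+ a b (x ∷ xs) = cong₂ _∷_ (sym (distribʳ x a b)) (·-distribʳ-+ a b xs)

  1·x≡x : ∀ {n} (x : Vec Carrier n) → 1# · x ≡ x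
  1·x≡x []       = refl
  1·x≡x (x ∷ xs) = cong₂ _∷_ (*-identityˡ x) (1·x≡x xs)

  x⊕[y⊕1·[x⊕y]]≡0 : ∀ {n} (x y : Vec Carrier n) → x ⊕ (y ⊕ (1# · (x ⊕ y))) ≡ zeroV
  x⊕[y⊕1·[x⊕y]]≡0 []       []       = refl
  x⊕[y⊕1·[x⊕y]]≡0 (x ∷ xs) (y ∷ ys) = cong₂ _∷_
    (solve 2 (λ x y → x :+ (y :+ con true :* (x :+ y)) := con false) refl x y)
    (x⊕[y⊕1·[x⊕y]]≡0 xs ys)

  c·x≡0⇒c≡0 : ∀ {n c} {x : Vec Carrier n} → Normalized x → c · x ≡ zeroV → c ≡ 0#
  c·x≡0⇒c≡0 {x = _ ∷ _} (inj₁ refl)     eq = trans (sym (*-identityʳ _)) (∷-injectiveˡ eq)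
  c·x≡0⇒c≡0 {x = _ ∷ _} (inj₂ (_ , nx)) eq = c·x≡0⇒c≡0 nx (∷-injectiveʳ eq)

  c·x⊕c·y≡0⇒x≡y : ∀ {n c} {x y : Vec Carrier n} → c ≢ 0# → (c · x) ⊕ (c · y) ≡ zeroV → x ≡ y
  c·x⊕c·y≡0⇒x≡y {x = []}    {[]}    c≢0 eq = refl
  c·x⊕c·y≡0⇒x≡y {x = _ ∷ _} {_ ∷ _} c≢0 eq = cong₂ _∷_
    (*-cancelˡ-nonZero c≢0 (x+y≡0⇒x≡y (∷-injectiveˡ eq))) (c·x⊕c·y≡0⇒x≡y c≢0 (∷-injectiveʳ eq))

  -- Both vectors have a leading 1. In the same position these force `c` = `d`; in different
  -- positions they force `c` = 0.
  proportional⇒≡ : ∀ {n c d} {x y : Vec Carrier n} → Normalized x → Normalized y → c ≢ 0# →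
    (c · x) ⊕ (d · y) ≡ zeroV → x ≡ y
  proportional⇒≡ {c = c} {d} {_ ∷ xs} {_ ∷ ys} (inj₁ refl) (inj₁ refl) c≢0 eq =
    cong (1# ∷_) (c·x⊕c·y≡0⇒x≡y c≢0 (subst (λ d → (c · xs) ⊕ (d · ys) ≡ zeroV) (sym c≡d) (∷-injectiveʳ eq)))
    where
    c≡d : c ≡ d
    c≡d = *-cancelˡ-nonZero (0≢1 ∘ sym)
      (trans (*-comm 1# c) (trans (x+y≡0⇒x≡y (∷-injectiveˡ eq)) (*-comm d 1#)))
  proportional⇒≡ {c = c} {d} {_ ∷ _} {_ ∷ _} (inj₁ refl) (inj₂ (refl , _)) c≢0 eq = contradiction
    (trans (solve 2 (λ c d → c := c :* con true :+ d :* con false) refl c d) (∷-injectiveˡ eq)) c≢0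
  proportional⇒≡ {c = c} {d} {_ ∷ xs} {_ ∷ ys} (inj₂ (refl , nx)) (inj₁ refl) c≢0 eq = contradiction
    (c·x≡0⇒c≡0 nx (trans (sym (0·x⊕y≡y ys _)) (trans (⊕-comm _ _)
      (subst (λ d → (c · xs) ⊕ (d · ys) ≡ zeroV) d≡0 (∷-injectiveʳ eq))))) c≢0
    where
    d≡0 : d ≡ 0#
    d≡0 = trans (solve 2 (λ c d → d := c :* con false :+ d :* con true) refl c d) (∷-injectiveˡ eq)
  proportional⇒≡ {x = _ ∷ _} {_ ∷ _} (inj₂ (refl , nx)) (inj₂ (refl , ny)) c≢0 eq =
    cong (0# ∷_) (proportional⇒≡ nx ny c≢0 (∷-injectiveʳ eq))

  module _ {n : ℕ} {x y z : Vec Carrier n} {a b c : Carrier} where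

    rotate : (a · x) ⊕ ((b · y) ⊕ (c · z)) ≡ zeroV → (b · y) ⊕ ((c · z) ⊕ (a · x)) ≡ zeroV
    rotate = trans (sym (⊕-rotate (a · x) (b · y) (c · z)))

    -- If `a` vanished, the relation would make `y` and `z` proportional, hence equal. Collinearity
    -- of distinct points may thus be read with all three coefficients nonzero.
    coefficient≢0 : Normalized y → Normalized z → y ≢ z → ¬ (a ≡ 0# × b ≡ 0# × c ≡ 0#) →
      (a · x) ⊕ ((b · y) ⊕ (c · z)) ≡ zeroV → a ≢ 0#
    coefficient≢0 ny nz y≢z ¬000 eq refl with b ≟ 0#
    ... | no  b≢0  = y≢z (proportional⇒≡ ny nz b≢0 (trans (sym (0·x⊕y≡y x _)) eq))
    ... | yes refl = y≢z (sym (proportional⇒≡ nz ny (λ c≡0 → ¬000 (refl , refl , c≡0))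
                       (trans (⊕-comm _ _) (trans (sym (0·x⊕y≡y x _)) eq))))

  coefficients≢0 : ∀ {n} {x y z : Vec Carrier n} {a b c} → Normalized x → Normalized y → Normalized z →
    x ≢ y → y ≢ z → x ≢ z → ¬ (a ≡ 0# × b ≡ 0# × c ≡ 0#) →
    (a · x) ⊕ ((b · y) ⊕ (c · z)) ≡ zeroV → a ≢ 0# × b ≢ 0# × c ≢ 0#
  coefficients≢0 {x = x} {y} {z} {a} {b} {c} nx ny nz x≢y y≢z x≢z ¬000 eq =
    coefficient≢0 {x = x} ny nz y≢z ¬000 eq ,
    coefficient≢0 {x = y} nz nx (x≢z ∘ sym) (λ (p , q , r) → ¬000 (r , p , q)) eq′ ,
    coefficient≢0 {x = z} nx ny x≢y (λ (p , q , r) → ¬000 (q , r , p)) (rotate {x = y} {z} {x} eq′)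
    where
    eq′ : (b · y) ⊕ ((c · z) ⊕ (a · x)) ≡ zeroV
    eq′ = rotate {x = x} {y} {z} eq

  ++-normalized : ∀ {m n} {x : Vec Carrier m} (y : Vec Carrier n) → Normalized x → Normalized (x ++ y)
  ++-normalized {x = _ ∷ _} y (inj₁ x≡1)        = inj₁ x≡1
  ++-normalized {x = _ ∷ _} y (inj₂ (x≡0 , nx)) = inj₂ (x≡0 , ++-normalized y nx)

  cap-⊆ : ∀ {N} {S T : PointSet N} → (∀ x → S x → T x) → IsCap T → IsCap S
  cap-⊆ S⊆T (norm , cap) = (λ x Sx → norm x (S⊆T x Sx)) ,
    (λ x y z Sx Sy Sz → cap x y z (S⊆T x Sx) (S⊆T y Sy) (S⊆T z Sz))

  secant⇒¬cap : ∀ {N} {S : PointSet N} {P x y c₁ c₂} → S x → S y → x ≢ y → ¬ S P →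
    P ≡ (c₁ · x) ⊕ (c₂ · y) → ¬ IsCap (λ z → S z ⊎ z ≡ P)
  secant⇒¬cap {S = S} {P} {x} {y} {c₁} {c₂} Sx Sy x≢y ¬SP refl (_ , cap) =
    cap x y P (inj₁ Sx) (inj₁ Sy) (inj₂ refl) x≢y
      (λ y≡P → ¬SP (subst S y≡P Sy)) (λ x≡P → ¬SP (subst S x≡P Sx))
      (c₁ , c₂ , 1# , (λ (_ , _ , 1≡0) → 0≢1 (sym 1≡0)) , x⊕[y⊕1·[x⊕y]]≡0 (c₁ · x) (c₂ · y))

  -- Products of the parabola (a, a²)

  double : ℕ → ℕ
  double zero    = zero
  double (suc s) = suc (suc (double s))

  withSquares : ∀ {s} → Vec Carrier s → Vec Carrier (double s)
  withSquares []       = []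
  withSquares (a ∷ as) = a ∷ a * a ∷ withSquares as

  withSquares-injective : ∀ {s} {a b : Vec Carrier s} → withSquares a ≡ withSquares b → a ≡ b
  withSquares-injective {a = []}    {[]}    eq = refl
  withSquares-injective {a = _ ∷ _} {_ ∷ _} eq =
    cong₂ _∷_ (∷-injectiveˡ eq) (withSquares-injective (∷-injectiveʳ (∷-injectiveʳ eq)))

  solvePairs : ∀ {c₁ c₂} → c₁ ≢ 0# → c₂ ≢ 0# → c₁ ≢ c₂ → ∀ {s} (v : Vec Carrier (double s)) →
    ∃[ α ] ∃[ β ] v ≡ (c₁ · withSquares α) ⊕ (c₂ · withSquares β)
  solvePairs c₁≢0 c₂≢0 c₁≢c₂ {zero}  []          = [] , [] , refl
  solvePairs c₁≢0 c₂≢0 c₁≢c₂ {suc s} (m ∷ n ∷ v)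
    with solvePair c₁≢0 c₂≢0 c₁≢c₂ m n | solvePairs c₁≢0 c₂≢0 c₁≢c₂ v
  ... | α , β , eq₁ , eq₂ | αs , βs , eqs = α ∷ αs , β ∷ βs , cong₂ _∷_ eq₁ (cong₂ _∷_ eq₂ eqs)

  scaled-sum : ∀ {a c l x y t} → c ≢ 0# → c * l ≡ a → a * x + (a * y + c * t) ≡ 0# → t ≡ l * (x + y)
  scaled-sum {c = c} {l} {x} {y} {t} c≢0 refl eq = *-cancelˡ-nonZero c≢0 (x+y≡0⇒x≡y
    (trans (solve 5 (λ c l x y t → c :* t :+ c :* (l :* (x :+ y)) := c :* l :* x :+ (c :* l :* y :+ c :* t))
              refl c l x y t) eq))

  -- Squaring is additive, so two points of the paraboloid product add up to the point whose
  -- parameter is the sum. A third point on their secant taken with equal weights is therefore a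
  -- multiple of such a point.
  withSquares-scaled-sum : ∀ {s a c l} (α β : Vec Carrier s) {t} → c ≢ 0# → c * l ≡ a →
    (a · withSquares α) ⊕ ((a · withSquares β) ⊕ (c · t)) ≡ zeroV → t ≡ l · withSquares (α ⊕ β)
  withSquares-scaled-sum []       []       {[]}         c≢0 cl≡a eq = refl
  withSquares-scaled-sum {l = l} (α ∷ αs) (β ∷ βs) {t ∷ t′ ∷ ts} c≢0 cl≡a eq = cong₂ _∷_
    (scaled-sum c≢0 cl≡a (∷-injectiveˡ eq))
    (cong₂ _∷_
      (trans (scaled-sum c≢0 cl≡a (∷-injectiveˡ (∷-injectiveʳ eq)))
             (cong (l *_) (solve 2 (λ α β → α :* α :+ β :* β := (α :+ β) :* (α :+ β)) refl α β)))
      (withSquares-scaled-sum αs βs c≢0 cl≡a (∷-injectiveʳ (∷-injectiveʳ eq))))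

  -- Shifting the parameters by `γ` eliminates the third point and leaves a u + b v = 0 and a u² + b
  -- v² = 0. If `u` were nonzero, these would give u = v, and then c u = (a + b) u = 0 with `c`
  -- nonzero.
  conic-collinear⇒≡ : ∀ {a b c α β γ} → a ≢ 0# → b ≢ 0# → c ≢ 0# → a + (b + c) ≡ 0# →
    a * α + (b * β + c * γ) ≡ 0# → a * (α * α) + (b * (β * β) + c * (γ * γ)) ≡ 0# → α ≡ β × β ≡ γ
  conic-collinear⇒≡ {a} {b} {c} {α} {β} {γ} a≢0 b≢0 c≢0 eq₀ eq₁ eq₂ =
    trans (x+y≡0⇒x≡y u≡0) (sym (x+y≡0⇒x≡y v≡0)) , x+y≡0⇒x≡y v≡0
    where
    u = α + γ
    v = β + γ
    au+bv≡0 : a * u + b * v ≡ 0#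
    au+bv≡0 = trans
      (solve 6 (λ a b c α β γ → a :* (α :+ γ) :+ b :* (β :+ γ) :=
        a :* α :+ (b :* β :+ c :* γ) :+ (a :+ (b :+ c)) :* γ) refl a b c α β γ)
      (trans (cong₂ (λ y z → y + z * γ) eq₁ eq₀) (solve 1 (λ γ → con false :+ con false :* γ := con false) refl γ))
    au²+bv²≡0 : a * (u * u) + b * (v * v) ≡ 0#
    au²+bv²≡0 = trans
      (solve 6 (λ a b c α β γ → a :* ((α :+ γ) :* (α :+ γ)) :+ b :* ((β :+ γ) :* (β :+ γ)) :=
        a :* (α :* α) :+ (b :* (β :* β) :+ c :* (γ :* γ)) :+ (a :+ (b :+ c)) :* (γ :* γ)) refl a b c α β γ)
      (trans (cong₂ (λ y z → y + z * (γ * γ)) eq₂ eq₀)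
        (solve 1 (λ γ → con false :+ con false :* (γ :* γ) := con false) refl γ))
    u≡0 : u ≡ 0#
    u≡0 with u ≟ 0#
    ... | yes u≡0 = u≡0
    ... | no  u≢0 = x*y≡0⇒y≡0 c≢0 (trans
            (solve 4 (λ a b c u → c :* u := a :* u :+ b :* u :+ (a :+ (b :+ c)) :* u) refl a b c u)
            (trans (cong₂ (λ y z → a * u + b * y + z * u) u≡v eq₀)
              (trans (cong (_+ 0# * u) au+bv≡0) (solve 1 (λ u → con false :+ con false :* u := con false) refl u))))
      where
      u≡v : u ≡ v
      u≡v = x+y≡0⇒x≡y (x*y≡0⇒y≡0 a≢0 (x*y≡0⇒y≡0 u≢0 (trans
        (solve 4 (λ a b u v → u :* (a :* (u :+ v)) :=
          a :* (u :* u) :+ b :* (v :* v) :+ (a :* u :+ b :* v) :* v) refl a b u v)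
        (trans (cong₂ (λ y z → y + z * v) au²+bv²≡0 au+bv≡0)
          (solve 1 (λ v → con false :+ con false :* v := con false) refl v)))))
    v≡0 : v ≡ 0#
    v≡0 = x*y≡0⇒y≡0 b≢0 (trans (solve 2 (λ a bv → bv := a :* con false :+ bv) refl a (b * v))
      (trans (cong (λ z → a * z + b * v) (sym u≡0)) au+bv≡0))

  conics-collinear⇒≡ : ∀ {s a b c} {α β γ : Vec Carrier s} → a ≢ 0# → b ≢ 0# → c ≢ 0# → a + (b + c) ≡ 0# →
    (a · withSquares α) ⊕ ((b · withSquares β) ⊕ (c · withSquares γ)) ≡ zeroV → α ≡ β × β ≡ γ
  conics-collinear⇒≡ {α = []} {[]} {[]} _ _ _ _ _ = refl , refl
  conics-collinear⇒≡ {α = _ ∷ _} {_ ∷ _} {_ ∷ _} a≢0 b≢0 c≢0 eq₀ eq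
    with conic-collinear⇒≡ a≢0 b≢0 c≢0 eq₀ (∷-injectiveˡ eq) (∷-injectiveˡ (∷-injectiveʳ eq))
       | conics-collinear⇒≡ a≢0 b≢0 c≢0 eq₀ (∷-injectiveʳ (∷-injectiveʳ eq))
  ... | refl , refl | refl , refl = refl , refl

-- The equation is supplied as `refl`, so that unification finds `f`. This gives access to a map
-- that occurs only inside the definition of `S`.
solutionMap : ∀ {A B : Set} {b : B} {f : A → B} (S : Set) → S ≡ (∃[ a ] b ≡ f a) → A → B
solutionMap {f = f} _ _ = f

-- The recursive form of the point set

module Construction (F : FiniteField) (1+1≡0 : CharacteristicTwo F)
  (K : Geometry.PointSet F 2) where
  open VectorProperties F 1+1≡0

  D : ∀ {n} → Vec Carrier (suc n) → Vec Carrier (3 ℕ.+ n)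
  D u = 0# ∷ head u ∷ u

  D-injective : ∀ {n} {u v : Vec Carrier (suc n)} → D u ≡ D v → u ≡ v
  D-injective eq = ∷-injectiveʳ (∷-injectiveʳ eq)

  D-normalized : ∀ {n} {u : Vec Carrier (suc n)} → Normalized u → Normalized (D u)
  D-normalized {u = _ ∷ _} (inj₁ u₀≡1)        = inj₂ (refl , inj₁ u₀≡1)
  D-normalized {u = _ ∷ _} (inj₂ (u₀≡0 , nu)) = inj₂ (refl , inj₂ (u₀≡0 , inj₂ (u₀≡0 , nu)))

  D-combination : ∀ {n a b c} {u v w : Vec Carrier (suc n)} → (a · u) ⊕ ((b · v) ⊕ (c · w)) ≡ zeroV →
    (a · D u) ⊕ ((b · D v) ⊕ (c · D w)) ≡ zeroV
  D-combination {a = a} {b} {c} {_ ∷ _} {_ ∷ _} {_ ∷ _} eq = cong₂ _∷_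
    (solve 3 (λ a b c → a :* con false :+ (b :* con false :+ c :* con false) := con false) refl a b c)
    (cong₂ _∷_ (∷-injectiveˡ eq) eq)

  -- X s is 𝒳 K s; the length 3 + double s is chosen so that the recursion in s typechecks on the nose.
  data X : ∀ s → Vec Carrier (3 ℕ.+ double s) → Set where
    join : ∀ {s x} → K x → (a : Vec Carrier s) → X s (x ++ withSquares a)
    lift : ∀ {s u} → X s u → X (suc s) (D u)

  -- Agreement of the recursive form with `𝒳`

  toList-injective : ∀ {n} {u v : Vec Carrier n} → toList u ≡ toList v → u ≡ v
  toList-injective {u = u} {v} eq = trans (sym (Vec.cast-is-id refl u)) (Vec.toList-injective refl u v eq)

  -- The list function in the definition of 𝒫 is local there and is also abstracted over the
  -- arguments j and y of 𝒫. Abstracting those two away from a value of it, in abstract-arguments,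
  -- lets unification recover the function itself as localSquares.
  record Coordinates (n : ℕ) : Set where
    constructor coordinates
    field vector : Vec Carrier (n ℕ.+ n)
  open Coordinates

  -- Dropping the two entries of one unfolding exposes the recursive call. Its own arguments have
  -- shrunk, while the abstracted ones are still `suc j` and `y`, so the two kinds can be told
  -- apart.
  localTail : ∀ j → Coordinates (suc j) → Vec Carrier (suc j) → List Carrier
  localTail j y a = List.drop 2 (solutionMap (𝒫 (suc j) (vector y)) refl a)

  mutual
    localSquares : ∀ n → Coordinates n → ∀ j → Vec Carrier j → List Carrier
    localSquares = _

    abstract-arguments : ∀ j y a as → localTail j y (a ∷ as) ≡ localTail j y (a ∷ as)
    abstract-arguments j y a as with suc j | y
    ... | n | y′ = refl {x = localSquares n y′ j as}

  localSquares≡ : ∀ n y {j} (as : Vec Carrier j) → localSquares n y j as ≡ toList (withSquares as)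
  localSquares≡ n y []       = refl
  localSquares≡ n y (a ∷ as) = cong (λ l → a ∷ a * a ∷ l) (localSquares≡ n y as)

  𝒫⇒withSquares : ∀ {j y} → 𝒫 j y → ∃[ a ] toList y ≡ toList (withSquares {j} a)
  𝒫⇒withSquares {j} {y} (a , eq) = a , trans eq (localSquares≡ j (coordinates y) a)

  withSquares⇒𝒫 : ∀ {j y} (a : Vec Carrier j) → toList y ≡ toList (withSquares a) → 𝒫 j y
  withSquares⇒𝒫 {j} {y} a eq = a , trans eq (sym (localSquares≡ j (coordinates y) a))

  double≡+ : ∀ s → double s ≡ s ℕ.+ s
  double≡+ zero    = refl
  double≡+ (suc s) = cong suc (trans (cong suc (double≡+ s)) (sym (ℕ.+-suc s s)))

  D^ : ∀ d {j} → Vec Carrier (3 ℕ.+ double j) → Vec Carrier (3 ℕ.+ double (d ℕ.+ j))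
  D^ zero    u = u
  D^ (suc d) u = D (D^ d u)

  -- Only the innermost `D` repeats `u₀`. Each outer one repeats a leading 0 and so contributes two
  -- zeros.
  toList-D^ : ∀ d {j} u₀ (us : Vec Carrier (2 ℕ.+ double j)) →
    toList (D^ (suc d) {j} (u₀ ∷ us)) ≡ List.replicate (suc (d ℕ.+ d)) 0# List.++ (u₀ ∷ u₀ ∷ toList us)
  toList-D^ zero    u₀ us = refl
  toList-D^ (suc d) u₀ us = trans (cong (λ l → 0# ∷ 0# ∷ l) (toList-D^ d u₀ us))
    (cong (λ n → List.replicate (suc n) 0# List.++ (u₀ ∷ u₀ ∷ toList us)) (cong suc (sym (ℕ.+-suc d d))))

  -- With s = `suc d ℕ.+ j`, the left side is the number of zeros in `Kj` and the right side the
  -- number in `toList-D^`.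
  leadingZeros : ∀ d j → (suc d ℕ.+ j) ℕ.+ (suc d ℕ.+ j) ∸ (j ℕ.+ j) ∸ 1 ≡ suc (d ℕ.+ d)
  leadingZeros d j = begin
    (suc d ℕ.+ j) ℕ.+ (suc d ℕ.+ j) ∸ (j ℕ.+ j) ∸ 1
      ≡⟨ cong (λ n → n ∸ (j ℕ.+ j) ∸ 1)
           (+-*-Solver.solve 2 (λ d j → d :+ℕ j :+ℕ (d :+ℕ j) :=ℕ d :+ℕ d :+ℕ (j :+ℕ j)) refl (suc d) j) ⟩
    suc d ℕ.+ suc d ℕ.+ (j ℕ.+ j) ∸ (j ℕ.+ j) ∸ 1
      ≡⟨ cong (_∸ 1) (ℕ.m+n∸n≡m (suc d ℕ.+ suc d) (j ℕ.+ j)) ⟩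
    d ℕ.+ suc d
      ≡⟨ ℕ.+-suc d d ⟩
    suc (d ℕ.+ d) ∎
    where
    open ≡-Reasoning
    open +-*-Solver using () renaming (_:+_ to _:+ℕ_; _:=_ to _:=ℕ_)

  X-D^ : ∀ d {j u} → X j u → X (d ℕ.+ j) (D^ d u)
  X-D^ zero    Xu = Xu
  X-D^ (suc d) Xu = lift (X-D^ d Xu)

  -- The equation is between dependent pairs, so matching on `refl` identifies `s` with `d ℕ.+ j`
  -- and no transport is left.
  X-layer : ∀ {s v} → X s v → ∃[ d ] ∃[ j ] ∃[ x ] ∃[ a ]
    K x × _≡_ {A = ∃[ s ] Vec Carrier (3 ℕ.+ double s)} (s , v) (d ℕ.+ j , D^ d (x ++ withSquares {j} a))
  X-layer (join Kx a) = 0 , _ , _ , a , Kx , refl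
  X-layer (lift Xu) with X-layer Xu
  ... | d , j , x , a , Kx , refl = suc d , j , x , a , Kx , refl

  -- The lengths built from `s ℕ.+ s` and `double s` agree only propositionally, so the two vectors
  -- are compared as lists.
  𝒳⇒X : ∀ {s v} (v′ : Vec Carrier (3 ℕ.+ double s)) → toList v′ ≡ toList v → 𝒳 K s v → X s v′
  𝒳⇒X {s} v′ v′≡v (inj₁ (x , y , _ , Kx , 𝒫y , v≡)) with 𝒫⇒withSquares 𝒫y
  ... | a , y≡ = subst (X s) (sym (toList-injective
    (trans v′≡v (trans v≡ (trans (cong (toList x List.++_) y≡) (sym (Vec.toList-++ x (withSquares a)))))))) (join Kx a)
  𝒳⇒X {s} v′ v′≡v (inj₂ (j , j<s , Y₀ , Y , (x₀ ∷ x₁ ∷ x₂ ∷ [] , y , _ , Kx , 𝒫y , Y≡) , v≡))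
    -- The layer `j` lies s - j applications of `D` deep, so `d` is s - j - 1.
    with 𝒫⇒withSquares 𝒫y | ℕ.m≤n⇒∃[o]m+o≡n j<s
  ... | a , y≡ | d , j+d≡s with refl ← trans (cong suc (ℕ.+-comm d j)) j+d≡s | refl ← List.∷-injectiveˡ Y≡ =
    subst (X s) (sym (toList-injective v′≡)) (X-D^ (suc d) (join Kx a))
    where
    open ≡-Reasoning
    v′≡ : toList v′ ≡ toList (D^ (suc d) (x₀ ∷ x₁ ∷ x₂ ∷ withSquares a))
    v′≡ = begin
      toList v′
        ≡⟨ trans v′≡v v≡ ⟩
      List.replicate (s ℕ.+ s ∸ (j ℕ.+ j) ∸ 1) 0# List.++ (x₀ ∷ x₀ ∷ toList Y)
        ≡⟨ cong₂ (λ n l → List.replicate n 0# List.++ (x₀ ∷ x₀ ∷ l)) (leadingZeros d j)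
             (trans (List.∷-injectiveʳ Y≡) (cong (λ l → x₁ ∷ x₂ ∷ l) y≡)) ⟩
      List.replicate (suc (d ℕ.+ d)) 0# List.++ (x₀ ∷ x₀ ∷ toList (x₁ ∷ x₂ ∷ withSquares a))
        ≡⟨ toList-D^ d x₀ (x₁ ∷ x₂ ∷ withSquares a) ⟨
      toList (D^ (suc d) (x₀ ∷ x₁ ∷ x₂ ∷ withSquares a)) ∎

  X⇒𝒳 : (∀ x → K x → Normalized x) → ∀ {s v v′} → toList v′ ≡ toList v → X s v′ → 𝒳 K s v
  X⇒𝒳 K-normalized v′≡v Xv′ with X-layer Xv′
  ... | zero , j , x , a , Kx , refl = inj₁
    (x , Vec.cast (double≡+ j) (withSquares a) , K-normalized x Kx , Kx ,
     withSquares⇒𝒫 a (Vec.toList-cast _ _) ,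
     trans (sym v′≡v) (trans (Vec.toList-++ x _) (cong (toList x List.++_) (sym (Vec.toList-cast _ _)))))
  ... | suc d , j , x@(x₀ ∷ x₁ ∷ x₂ ∷ []) , a , Kx , refl = inj₂
    (j , s≤s (ℕ.m≤n+m j d) , x₀ , x₁ ∷ x₂ ∷ y ,
     (x , y , K-normalized x Kx , Kx , withSquares⇒𝒫 a (Vec.toList-cast _ _) , refl) ,
     trans (sym v′≡v) (trans (toList-D^ d x₀ (x₁ ∷ x₂ ∷ withSquares a))
       (cong₂ (λ n l → List.replicate n 0# List.++ (x₀ ∷ x₀ ∷ x₁ ∷ x₂ ∷ l))
         (sym (leadingZeros d j)) (sym (Vec.toList-cast _ _)))))
    where
    y = Vec.cast (double≡+ j) (withSquares a)

  completeCap-resp : ∀ {M N m} {S : PointSet M} {T : PointSet N} → M ≡ N →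
    (∀ u v → toList u ≡ toList v → S u ⇔ T v) →
    IsCompleteCap S × HasSize S m → IsCompleteCap T × HasSize T m
  completeCap-resp {S = S} {T} refl S⇔T ((S-cap , S-complete) , S-size) =
    (cap-⊆ (λ x → from (S⇔T x x refl)) S-cap ,
     λ P nP ¬TP → S-complete P nP (¬TP ∘ to (S⇔T P P refl)) ∘
       cap-⊆ λ { x (inj₁ Sx) → inj₁ (to (S⇔T x x refl) Sx) ; x (inj₂ x≡P) → inj₂ x≡P }) ,
    size-resp-⇔ (λ x → S⇔T x x refl) S-size
    where open Equivalence

  -- The cap property

  module Cap
    (K-cap : IsCap K) (Ke₁ : K e₁) (Ke₂ : K e₂)
    (K∞ : ∀ x → K x → head x ≡ 0# → x ≡ e₁ ⊎ x ≡ e₂)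
    (K-avoids : ∀ A a → S₁ K A → ¬ K (1# ∷ a ∷ (A * (a * a)) ∷ [])) where

    AtInfinity : Carrier → Carrier → Set
    AtInfinity x₁ x₂ = x₁ ≡ 1# × x₂ ≡ 0# ⊎ x₁ ≡ 0# × x₂ ≡ 1#

    K-cases : ∀ {x₀ x₁ x₂} → K (x₀ ∷ x₁ ∷ x₂ ∷ []) →
      x₀ ≡ 1# ⊎ x₀ ≡ 0# × AtInfinity x₁ x₂
    K-cases Kx with proj₁ K-cap _ Kx
    ... | inj₁ x₀≡1 = inj₁ x₀≡1
    ... | inj₂ (x₀≡0 , _) with K∞ _ Kx x₀≡0
    ...   | inj₁ refl = inj₂ (refl , inj₁ (refl , refl))
    ...   | inj₂ refl = inj₂ (refl , inj₂ (refl , refl))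

    -- The form x₁ + x₂ vanishes on every `D u` and on (0, 1, 1), so this value lets it compare the
    -- coefficients of two points at infinity.
    ∞-sum : ∀ {x₁ x₂} → AtInfinity x₁ x₂ → x₁ + x₂ ≡ 1#
    ∞-sum (inj₁ (refl , refl)) = +-identityʳ 1#
    ∞-sum (inj₂ (refl , refl)) = +-identityˡ 1#

    -- The pair `e₁`, `e₂` yields this value, which `X-avoids` needs when it descends from a lift.
    1∈S₁ : S₁ K 1#
    1∈S₁ = 0# , 1# , 0# , 0# , 1# , Ke₁ , Ke₂ , (0≢1 ∘ sym) , +-comm 0# 1# , sym (+-identityʳ 1#)

    -- For a join, the two points at infinity are excluded because `l * γ` and `l * (γ * γ)` vanish
    -- together. An affine point has `l * A` = 1, so it is (1, lγ, A(lγ)²), which is excluded for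
    -- `A` in `S₁ K`. For a lift, the repeated entry gives γ = γ², and the vector below has the same
    -- form with `γ`, which is 0 or 1, in place of `A`.
    X-avoids : ∀ {s u l A} → X s u → (γ : Vec Carrier (suc s)) → l ≢ 0# → A ≡ 0# ⊎ S₁ K A →
      u ≢ l · (A ∷ withSquares γ)
    X-avoids {l = l} {A} (join {x = x₀ ∷ x₁ ∷ x₂ ∷ []} Kx a) (γ ∷ _) l≢0 A∈ eq
      with x₀≡ ← ∷-injectiveˡ eq | x₁≡ ← ∷-injectiveˡ (∷-injectiveʳ eq)
         | x₂≡ ← ∷-injectiveˡ (∷-injectiveʳ (∷-injectiveʳ eq))
      with K-cases Kx
    ... | inj₂ (_ , inj₁ (x₁≡1 , x₂≡0)) = 0≢1 (begin
      0#       ≡⟨ zeroʳ l ⟨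
      l * 0#   ≡⟨ cong (l *_) (x*x≡0⇒x≡0 (x*y≡0⇒y≡0 l≢0 (trans (sym x₂≡) x₂≡0))) ⟨
      l * γ    ≡⟨ trans (sym x₁≡) x₁≡1 ⟩
      1#       ∎)
      where open ≡-Reasoning
    ... | inj₂ (_ , inj₂ (x₁≡0 , x₂≡1)) = 0≢1 (begin
      0#             ≡⟨ solve 2 (λ l γ → con false := l :* (con false :* γ)) refl l γ ⟩
      l * (0# * γ)   ≡⟨ cong (λ z → l * (z * γ)) (x*y≡0⇒y≡0 l≢0 (trans (sym x₁≡) x₁≡0)) ⟨
      l * (γ * γ)    ≡⟨ trans (sym x₂≡) x₂≡1 ⟩
      1#             ∎)
      where open ≡-Reasoning
    ... | inj₁ x₀≡1 with A∈
    ...   | inj₁ A≡0 = 0≢1 (trans (sym (zeroʳ l)) (trans (cong (l *_) (sym A≡0)) (trans (sym x₀≡) x₀≡1)))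
    ...   | inj₂ SA = K-avoids A (l * γ) SA (subst K (cong₂ _∷_ x₀≡1 (cong₂ _∷_ x₁≡ (cong (_∷ []) x₂≡′))) Kx)
      where
      open ≡-Reasoning
      x₂≡′ : x₂ ≡ A * (l * γ * (l * γ))
      x₂≡′ = begin
        x₂                       ≡⟨ x₂≡ ⟩
        l * (γ * γ)              ≡⟨ *-identityˡ _ ⟨
        1# * (l * (γ * γ))       ≡⟨ cong (_* (l * (γ * γ))) (trans (sym x₀≡1) x₀≡) ⟩
        l * A * (l * (γ * γ))    ≡⟨ solve 3 (λ l A γ → l :* A :* (l :* (γ :* γ)) := A :* (l :* γ :* (l :* γ))) refl l A γ ⟩
        A * (l * γ * (l * γ))    ∎
    X-avoids {l = l} {A} (lift {u = w ∷ ws} Xw) (γ ∷ γs) l≢0 A∈ eq =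
      X-avoids Xw γs l≢0 γ∈ (cong₂ _∷_ w≡lγ (∷-injectiveʳ (∷-injectiveʳ (∷-injectiveʳ eq))))
      where
      w≡lγ : w ≡ l * γ
      w≡lγ = ∷-injectiveˡ (∷-injectiveʳ eq)
      γ≡γ² : γ ≡ γ * γ
      γ≡γ² = *-cancelˡ-nonZero l≢0 (trans (sym w≡lγ) (∷-injectiveˡ (∷-injectiveʳ (∷-injectiveʳ eq))))
      γ∈ : γ ≡ 0# ⊎ S₁ K γ
      γ∈ with γ ≟ 0#
      ... | yes γ≡0 = inj₁ γ≡0
      ... | no  γ≢0 = inj₂ (subst (S₁ K) (*-cancelˡ-nonZero γ≢0 (trans (*-identityʳ γ) γ≡γ²)) 1∈S₁)

    -- Lifts have first coordinate 0 and equal second and third coordinates, so the relation would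
    -- force x₀ = 0 and x₁ = x₂ on a point of `K`.
    ¬collinear-join-lift-lift : ∀ {s x a b c} {u v : Vec Carrier (3 ℕ.+ double s)} {α : Vec Carrier (suc s)} →
      K x → a ≢ 0# → (a · (x ++ withSquares α)) ⊕ ((b · D u) ⊕ (c · D v)) ≢ zeroV
    ¬collinear-join-lift-lift {x = x₀ ∷ x₁ ∷ x₂ ∷ []} {a} {b} {c} {u ∷ _} {v ∷ _} {_ ∷ _} Kx a≢0 eq
      with K-cases Kx | x₁≡x₂
      where
      x₁≡x₂ : x₁ ≡ x₂
      x₁≡x₂ = *-cancelˡ-nonZero a≢0 (trans (x+y≡0⇒x≡y (∷-injectiveˡ (∷-injectiveʳ eq)))
        (sym (x+y≡0⇒x≡y (∷-injectiveˡ (∷-injectiveʳ (∷-injectiveʳ eq))))))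
    ... | inj₂ (_ , inj₁ (refl , refl)) | 1≡0 = 0≢1 (sym 1≡0)
    ... | inj₂ (_ , inj₂ (refl , refl)) | 0≡1 = 0≢1 0≡1
    ... | inj₁ refl | _ = a≢0 (trans
      (solve 3 (λ a b c → a := a :* con true :+ (b :* con false :+ c :* con false)) refl a b c)
      (∷-injectiveˡ eq))

    -- The first three rows force `a` = `b`. Then `u` is a multiple of (x₁ + y₁, squares of
    -- `α ⊕ β`), the shape that `X-avoids` rules out.
    ¬collinear-join-join-lift : ∀ {s x y a b c u} {α β : Vec Carrier (suc s)} → K x → K y → X s u →
      a ≢ 0# → b ≢ 0# → c ≢ 0# →
      (a · (x ++ withSquares α)) ⊕ ((b · (y ++ withSquares β)) ⊕ (c · D u)) ≢ zeroV
    ¬collinear-join-join-lift {x = x₀ ∷ x₁ ∷ x₂ ∷ []} {y₀ ∷ y₁ ∷ y₂ ∷ []} {a} {b} {c} {u₀ ∷ us} {α} {β}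
      Kx Ky Xu a≢0 b≢0 c≢0 eq = coefficients-agree a≡b
      where
      open ≡-Reasoning
      row₀ : a * x₀ + (b * y₀ + c * 0#) ≡ 0#
      row₀ = ∷-injectiveˡ eq
      row₁ : a * x₁ + (b * y₁ + c * u₀) ≡ 0#
      row₁ = ∷-injectiveˡ (∷-injectiveʳ eq)
      row₂ : a * x₂ + (b * y₂ + c * u₀) ≡ 0#
      row₂ = ∷-injectiveˡ (∷-injectiveʳ (∷-injectiveʳ eq))
      rows : (a · withSquares α) ⊕ ((b · withSquares β) ⊕ (c · us)) ≡ zeroV
      rows = ∷-injectiveʳ (∷-injectiveʳ (∷-injectiveʳ eq))

      a≡b : a ≡ b
      a≡b with K-cases Kx | K-cases Ky
      ... | inj₁ refl       | inj₁ refl       = x+y≡0⇒x≡y (trans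
        (solve 3 (λ a b c → a :+ b := a :* con true :+ (b :* con true :+ c :* con false)) refl a b c) row₀)
      ... | inj₁ refl       | inj₂ (refl , _) = contradiction (trans
        (solve 3 (λ a b c → a := a :* con true :+ (b :* con false :+ c :* con false)) refl a b c) row₀) a≢0
      ... | inj₂ (refl , _) | inj₁ refl       = contradiction (trans
        (solve 3 (λ a b c → b := a :* con false :+ (b :* con true :+ c :* con false)) refl a b c) row₀) b≢0
      ... | inj₂ (_ , x∞)   | inj₂ (_ , y∞)   = x+y≡0⇒x≡y (begin
        a + b
          ≡⟨ cong₂ _+_ (*-identityʳ a) (*-identityʳ b) ⟨
        a * 1# + b * 1#
          ≡⟨ cong₂ (λ y z → a * y + b * z) (∞-sum x∞) (∞-sum y∞) ⟨
        a * (x₁ + x₂) + b * (y₁ + y₂)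
          ≡⟨ solve 7 (λ a b x₁ x₂ y₁ y₂ cu → a :* (x₁ :+ x₂) :+ b :* (y₁ :+ y₂) :=
               a :* x₁ :+ (b :* y₁ :+ cu) :+ (a :* x₂ :+ (b :* y₂ :+ cu))) refl a b x₁ x₂ y₁ y₂ (c * u₀) ⟩
        a * x₁ + (b * y₁ + c * u₀) + (a * x₂ + (b * y₂ + c * u₀))
          ≡⟨ cong₂ _+_ row₁ row₂ ⟩
        0# + 0#
          ≡⟨ +-identityʳ 0# ⟩
        0# ∎)

      coefficients-agree : a ≡ b → ⊥
      coefficients-agree refl = X-avoids Xu (α ⊕ β) l≢0 A∈
        (cong₂ _∷_ u₀≡ (withSquares-scaled-sum α β c≢0 cl≡a rows))
        where
        l = c ⁻¹ * a
        cl≡a : c * l ≡ a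
        cl≡a = trans (sym (*-assoc c (c ⁻¹) a)) (trans (cong (_* a) (⁻¹-inverse c c≢0)) (*-identityˡ a))
        l≢0 : l ≢ 0#
        l≢0 l≡0 = a≢0 (trans (sym cl≡a) (trans (cong (c *_) l≡0) (zeroʳ c)))
        u₀≡ : u₀ ≡ l * (x₁ + y₁)
        u₀≡ = scaled-sum c≢0 cl≡a row₁
        x₀≡y₀ : x₀ ≡ y₀
        x₀≡y₀ = x+y≡0⇒x≡y (x*y≡0⇒y≡0 l≢0 (sym (scaled-sum c≢0 cl≡a row₀)))
        -- Rows 1 and 2 share the entry `u₀`, which gives the condition x₂ + y₂ = x₁ + y₁ in `S₁`.
        A∈ : x₁ + y₁ ≡ 0# ⊎ S₁ K (x₁ + y₁)
        A∈ with (x₁ + y₁) ≟ 0#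
        ... | yes A≡0 = inj₁ A≡0
        ... | no  A≢0 = inj₂ (x₀ , x₁ , x₂ , y₁ , y₂ , Kx ,
                subst (λ z → K (z ∷ y₁ ∷ y₂ ∷ [])) (sym x₀≡y₀) Ky , A≢0 ∘ x≡y⇒x+y≡0 ,
                *-cancelˡ-nonZero l≢0 (trans (sym (scaled-sum c≢0 cl≡a row₂)) u₀≡) , refl)

    -- Distinct points of the cap may have the same plane part. If two plane parts agree, their
    -- terms merge and the third is proportional to them; if all differ, the arc property is
    -- violated.
    K-combination⇒≡ : ∀ {x y z a b c} → K x → K y → K z → a ≢ 0# → b ≢ 0# → c ≢ 0# →
      (a · x) ⊕ ((b · y) ⊕ (c · z)) ≡ zeroV → x ≡ y × y ≡ z
    K-combination⇒≡ {x} {y} {z} {a} {b} {c} Kx Ky Kz a≢0 b≢0 c≢0 eq = by-cases (x ≟ᵛ y) (y ≟ᵛ z) (x ≟ᵛ z)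
      where
      _≟ᵛ_ = Vec.≡-dec _≟_
      norm = proj₁ K-cap
      two-equal : ∀ {v w d e f} → K v → K w → d ≢ 0# →
        (d · v) ⊕ ((e · w) ⊕ (f · w)) ≡ zeroV → v ≡ w
      two-equal {v} {w} {d} {e} {f} Kv Kw d≢0 eq = proportional⇒≡ (norm v Kv) (norm w Kw) d≢0
        (trans (cong ((d · v) ⊕_) (sym (·-distribʳ-+ e f w))) eq)
      by-cases : Dec (x ≡ y) → Dec (y ≡ z) → Dec (x ≡ z) → x ≡ y × y ≡ z
      by-cases (yes refl) _ _ = refl , sym (two-equal Kz Kx c≢0
        (rotate {x = x} {z} {x} (rotate {x = x} {x} {z} eq)))
      by-cases (no x≢y) (yes refl) _ = contradiction (two-equal Kx Ky a≢0 eq) x≢y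
      by-cases (no x≢y) (no y≢z) (yes refl) =
        contradiction (sym (two-equal Ky Kx b≢0 (rotate {x = x} {y} {x} eq))) x≢y
      by-cases (no x≢y) (no y≢z) (no x≢z) = contradiction
        (a , b , c , (λ (a≡0 , _) → a≢0 a≡0) , eq) (proj₂ K-cap x y z Kx Ky Kz x≢y y≢z x≢z)

    join-collinear⇒≡ : ∀ {s x y z a b c} {α β γ : Vec Carrier s} → K x → K y → K z →
      a ≢ 0# → b ≢ 0# → c ≢ 0# →
      (a · (x ++ withSquares α)) ⊕ ((b · (y ++ withSquares β)) ⊕ (c · (z ++ withSquares γ))) ≡ zeroV →
      x ++ withSquares α ≡ y ++ withSquares β
    join-collinear⇒≡ {x = x@(_ ∷ _ ∷ _ ∷ [])} {y@(_ ∷ _ ∷ _ ∷ [])} {z@(_ ∷ _ ∷ _ ∷ [])} {a} {b} {c}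
      Kx Ky Kz a≢0 b≢0 c≢0 eq = join-≡ (K-combination⇒≡ Kx Ky Kz a≢0 b≢0 c≢0 eq₃)
      where
      eq₃ : (a · x) ⊕ ((b · y) ⊕ (c · z)) ≡ zeroV
      eq₃ = cong₂ _∷_ (∷-injectiveˡ eq) (cong₂ _∷_ (∷-injectiveˡ (∷-injectiveʳ eq))
              (cong₂ _∷_ (∷-injectiveˡ (∷-injectiveʳ (∷-injectiveʳ eq))) refl))
      join-≡ : x ≡ y × y ≡ z → _
      -- With a common normalized `x`, `eq₃` says a + (b + c) = 0, the constant row of the conics.
      join-≡ (refl , refl) = cong (λ α → x ++ withSquares α) (proj₁ (conics-collinear⇒≡ a≢0 b≢0 c≢0
        (c·x≡0⇒c≡0 (proj₁ K-cap x Kx) (trans (sym (trans (cong ((a · x) ⊕_) (·-distribʳ-+ b c x))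
          (·-distribʳ-+ a (b + c) x))) eq₃))
        (∷-injectiveʳ (∷-injectiveʳ (∷-injectiveʳ eq)))))

    X-normalized : ∀ {s x} → X s x → Normalized x
    X-normalized (join Kx a) = ++-normalized (withSquares a) (proj₁ K-cap _ Kx)
    X-normalized (lift Xu)   = D-normalized (X-normalized Xu)

    -- The cases are sorted by the number of joins; rotation puts the joins first, and three lifts
    -- descend to the layer below.
    ¬combination : ∀ {s x y z a b c} → X s x → X s y → X s z → x ≢ y → y ≢ z → x ≢ z →
      a ≢ 0# × b ≢ 0# × c ≢ 0# → (a · x) ⊕ ((b · y) ⊕ (c · z)) ≢ zeroV
    ¬combination (join Kx α) (join Ky β) (join Kz γ) x≢y _ _ (a≢0 , b≢0 , c≢0) eq =
      x≢y (join-collinear⇒≡ Kx Ky Kz a≢0 b≢0 c≢0 eq)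
    ¬combination (join Kx α) (join Ky β) (lift Xw) _ _ _ (a≢0 , b≢0 , c≢0) eq =
      ¬collinear-join-join-lift Kx Ky Xw a≢0 b≢0 c≢0 eq
    ¬combination {x = x} {y} {z} (join Kx α) (lift Xv) (join Kz γ) _ _ _ (a≢0 , b≢0 , c≢0) eq =
      ¬collinear-join-join-lift Kz Kx Xv c≢0 a≢0 b≢0 (rotate {x = y} {z} {x} (rotate {x = x} {y} {z} eq))
    ¬combination {x = x} {y} {z} (lift Xu) (join Ky β) (join Kz γ) _ _ _ (a≢0 , b≢0 , c≢0) eq =
      ¬collinear-join-join-lift Ky Kz Xu b≢0 c≢0 a≢0 (rotate {x = x} {y} {z} eq)
    ¬combination (join Kx α) (lift {u = v} Xv) (lift {u = w} Xw) _ _ _ (a≢0 , _) eq =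
      ¬collinear-join-lift-lift {u = v} {w} Kx a≢0 eq
    ¬combination {x = x} {y} {z} (lift {u = u} Xu) (join Ky β) (lift {u = w} Xw) _ _ _ (_ , b≢0 , _) eq =
      ¬collinear-join-lift-lift {u = w} {u} Ky b≢0 (rotate {x = x} {y} {z} eq)
    ¬combination {x = x} {y} {z} (lift {u = u} Xu) (lift {u = v} Xv) (join Kz γ) _ _ _ (_ , _ , c≢0) eq =
      ¬collinear-join-lift-lift {u = u} {v} Kz c≢0 (rotate {x = y} {z} {x} (rotate {x = x} {y} {z} eq))
    ¬combination (lift Xu) (lift Xv) (lift Xw) Du≢Dv Dv≢Dw Du≢Dw abc≢0 eq =
      ¬combination Xu Xv Xw (Du≢Dv ∘ cong D) (Dv≢Dw ∘ cong D) (Du≢Dw ∘ cong D) abc≢0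
        (∷-injectiveʳ (∷-injectiveʳ eq))

    X-cap : ∀ s → IsCap (X s)
    X-cap s = (λ _ → X-normalized) ,
      λ x y z Xx Xy Xz x≢y y≢z x≢z (a , b , c , ¬000 , eq) →
        ¬combination Xx Xy Xz x≢y y≢z x≢z
          (coefficients≢0 (X-normalized Xx) (X-normalized Xy) (X-normalized Xz) x≢y y≢z x≢z ¬000 eq) eq

    -- The sum-point on the line at infinity

    Q₀ : Vec Carrier 3
    Q₀ = 0# ∷ 1# ∷ 1# ∷ []

    -- For two affine points the first coordinate gives c + d = 0. One affine point would get
    -- coefficient 0 and make `Q₀` a multiple of `e₁` or `e₂`. For two points at infinity the form
    -- x₁ + x₂ gives c + d = 0.
    Q₀-sumPoint : IsSumPoint K Q₀
    Q₀-sumPoint = inj₂ (refl , inj₁ refl) , Q₀∉K , equal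
      where
      Q₀∉K : ¬ K Q₀
      Q₀∉K KQ₀ with K∞ _ KQ₀ refl
      ... | inj₁ eq = 0≢1 (sym (∷-injectiveˡ (∷-injectiveʳ (∷-injectiveʳ eq))))
      ... | inj₂ eq = 0≢1 (sym (∷-injectiveˡ (∷-injectiveʳ eq)))

      c*x₁≢c*x₂ : ∀ {c x₁ x₂} → AtInfinity x₁ x₂ → 1# ≡ c * x₁ → 1# ≢ c * x₂
      c*x₁≢c*x₂ {c} (inj₁ (refl , refl)) _ eq = 0≢1 (sym (trans eq (zeroʳ c)))
      c*x₁≢c*x₂ {c} (inj₂ (refl , refl)) eq _ = 0≢1 (sym (trans eq (zeroʳ c)))

      mixed : ∀ {x₀ x₁ x₂ y₁ y₂ c d} → x₀ ≡ 1# → AtInfinity y₁ y₂ →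
        0# ≡ c * x₀ + d * 0# → 1# ≡ c * x₁ + d * y₁ → 1# ≢ c * x₂ + d * y₂
      mixed {x₁ = x₁} {x₂} {y₁} {y₂} {c} {d} refl y∞ eq₀ eq₁ eq₂
        with refl ← trans (solve 2 (λ c d → c := c :* con true :+ d :* con false) refl c d) (sym eq₀) =
        c*x₁≢c*x₂ y∞ (trans eq₁ (drop-zero x₁ (d * y₁))) (trans eq₂ (drop-zero x₂ (d * y₂)))
        where
        drop-zero : ∀ x y → 0# * x + y ≡ y
        drop-zero = solve 2 (λ x y → con false :* x :+ y := y) refl

      equal : ∀ P₁ P₂ c₁ c₂ → K P₁ → K P₂ → P₁ ≢ P₂ → Q₀ ≡ (c₁ · P₁) ⊕ (c₂ · P₂) → c₁ ≡ c₂
      equal (x₀ ∷ x₁ ∷ x₂ ∷ []) (y₀ ∷ y₁ ∷ y₂ ∷ []) c d Kx Ky _ eq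
        with eq₀ ← ∷-injectiveˡ eq | eq₁ ← ∷-injectiveˡ (∷-injectiveʳ eq)
           | eq₂ ← ∷-injectiveˡ (∷-injectiveʳ (∷-injectiveʳ eq))
        with K-cases Kx | K-cases Ky
      ... | inj₁ refl | inj₁ refl = x+y≡0⇒x≡y (trans
        (solve 2 (λ c d → c :+ d := c :* con true :+ d :* con true) refl c d) (sym eq₀))
      ... | inj₁ x₀≡1 | inj₂ (refl , y∞) = contradiction eq₂ (mixed x₀≡1 y∞ eq₀ eq₁)
      ... | inj₂ (refl , x∞) | inj₁ y₀≡1 = contradiction (trans eq₂ (+-comm _ _))
        (mixed y₀≡1 x∞ (trans eq₀ (+-comm _ _)) (trans eq₁ (+-comm _ _)))
      ... | inj₂ (_ , x∞) | inj₂ (_ , y∞) = x+y≡0⇒x≡y (begin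
        c + d
          ≡⟨ cong₂ _+_ (*-identityʳ c) (*-identityʳ d) ⟨
        c * 1# + d * 1#
          ≡⟨ cong₂ (λ y z → c * y + d * z) (∞-sum x∞) (∞-sum y∞) ⟨
        c * (x₁ + x₂) + d * (y₁ + y₂)
          ≡⟨ solve 6 (λ c d x₁ x₂ y₁ y₂ → c :* (x₁ :+ x₂) :+ d :* (y₁ :+ y₂) :=
               c :* x₁ :+ d :* y₁ :+ (c :* x₂ :+ d :* y₂)) refl c d x₁ x₂ y₁ y₂ ⟩
        c * x₁ + d * y₁ + (c * x₂ + d * y₂)
          ≡⟨ cong₂ _+_ eq₁ eq₂ ⟨
        1# + 1#
          ≡⟨ 1+1≡0 ⟩
        0# ∎)
        where open ≡-Reasoning

    K⇒X₀ : ∀ {x} → K x → X 0 x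
    K⇒X₀ {_ ∷ _ ∷ _ ∷ []} Kx = join Kx []

    -- Completeness

    module Complete
      (K-complete : ∀ P → Normalized P → ¬ K P → ¬ IsCap (λ x → K x ⊎ x ≡ P))
      (sumPoint-unique : ∀ Q → IsSumPoint K Q → Q ≡ Q₀)
      (¬binary : ¬ (∀ c → c ≢ 0# → c ≡ 1#)) where

      -- `D` is linear and injective on vectors, so it carries a collinear triple of the lower layer
      -- to one of the upper layer.
      complete-D : ∀ {s w} → ¬ IsCap (λ x → X s x ⊎ x ≡ w) → Normalized w →
        ¬ IsCap (λ x → X (suc s) x ⊎ x ≡ D w)
      complete-D {s} {w} ¬cap nw (_ , cap) = ¬cap
        ( (λ { x (inj₁ Xx) → X-normalized Xx ; x (inj₂ refl) → nw })
        , λ x y z Sx Sy Sz x≢y y≢z x≢z (a , b , c , ¬000 , eq) →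
            cap (D x) (D y) (D z) (D-member Sx) (D-member Sy) (D-member Sz)
              (x≢y ∘ D-injective) (y≢z ∘ D-injective) (x≢z ∘ D-injective)
              (a , b , c , ¬000 , D-combination {u = x} {y} {z} eq))
        where
        D-member : ∀ {x} → X s x ⊎ x ≡ w → X (suc s) (D x) ⊎ D x ≡ D w
        D-member (inj₁ Xx)   = inj₁ (lift Xx)
        D-member (inj₂ refl) = inj₂ refl

      module _ {s : ℕ} {x : Vec Carrier 3} {v : Vec Carrier (double s)} (¬X : ¬ X s (x ++ v)) where

        -- The premise about `y ≡ z` allows both joined points to lie above `x` itself. If their
        -- parameters agreed too, weights of sum 1 would make `v` equal to `withSquares α`, and the
        -- point would already be in `X s`.
        joins-secant : ∀ {y z c₁ c₂} → K y → K z → c₁ ≢ 0# → c₂ ≢ 0# → c₁ ≢ c₂ →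
          (y ≡ z → y ≡ x × c₁ + c₂ ≡ 1#) → x ≡ (c₁ · y) ⊕ (c₂ · z) →
          ¬ IsCap (λ w → X s w ⊎ w ≡ x ++ v)
        joins-secant {y} {z} {c₁} {c₂} Ky Kz c₁≢0 c₂≢0 c₁≢c₂ y≡z⇒ x≡ with solvePairs c₁≢0 c₂≢0 c₁≢c₂ v
        ... | α , β , v≡ = secant⇒¬cap (join Ky α) (join Kz β) distinct ¬X
          (trans (cong₂ _++_ x≡ v≡) (combination-++ y z))
          where
          combination-++ : ∀ {m} (y z : Vec Carrier m) →
            ((c₁ · y) ⊕ (c₂ · z)) ++ ((c₁ · withSquares α) ⊕ (c₂ · withSquares β))
              ≡ (c₁ · (y ++ withSquares α)) ⊕ (c₂ · (z ++ withSquares β))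
          combination-++ []      []      = refl
          combination-++ (_ ∷ y) (_ ∷ z) = cong (_ ∷_) (combination-++ y z)

          distinct : y ++ withSquares α ≢ z ++ withSquares β
          distinct eq with Vec.++-injective y z eq
          ... | refl , α≡β with y≡z⇒ refl
          ...   | refl , sum≡1 = ¬X (subst (λ w → X s (x ++ w)) (sym v≡α) (join Ky α))
            where
            v≡α : v ≡ withSquares α
            v≡α = trans v≡ (trans (cong (λ w → (c₁ · withSquares α) ⊕ (c₂ · w)) (sym α≡β))
              (trans (·-distribʳ-+ c₁ c₂ _) (trans (cong (_· withSquares α) sum≡1) (1·x≡x _))))

        above-arc : K x → ¬ IsCap (λ w → X s w ⊎ w ≡ x ++ v)
        above-arc Kx cap = ¬binary 0-or-1
          where
          c+[c+1]≡1 : ∀ c → c + (c + 1#) ≡ 1#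
          c+[c+1]≡1 = solve 1 (λ c → c :+ (c :+ con true) := con true) refl
          -- No particular `c` has to be found: any `c` other than 0 and 1 gives the weights `c` and
          -- `c + 1#`, which are nonzero, distinct and of sum 1, and so refutes `cap`.
          0-or-1 : ∀ c → c ≢ 0# → c ≡ 1#
          0-or-1 c c≢0 with c ≟ 1#
          ... | yes c≡1 = c≡1
          ... | no  c≢1 = contradiction cap (joins-secant Kx Kx c≢0 (c≢1 ∘ x+y≡0⇒x≡y)
            (λ c≡c+1 → 0≢1 (trans (sym (x≡y⇒x+y≡0 c≡c+1)) (c+[c+1]≡1 c)))
            (λ _ → refl , c+[c+1]≡1 c)
            (sym (trans (·-distribʳ-+ c (c + 1#) x) (trans (cong (_· x) (c+[c+1]≡1 c)) (1·x≡x x)))))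

        -- In contrapositive form: under `cap`, unequal weights on a secant through `x` are
        -- impossible by `joins-secant`, and so `x` would be a sum-point.
        above-nonSumPoint : Normalized x → ¬ K x → ¬ IsSumPoint K x → ¬ IsCap (λ w → X s w ⊎ w ≡ x ++ v)
        above-nonSumPoint nx ¬Kx ¬Sx cap = ¬Sx (nx , ¬Kx , equal)
          where
          equal : ∀ y z c₁ c₂ → K y → K z → y ≢ z → x ≡ (c₁ · y) ⊕ (c₂ · z) → c₁ ≡ c₂
          equal y z c₁ c₂ Ky Kz y≢z refl with c₁ ≟ c₂
          ... | yes c₁≡c₂ = c₁≡c₂
          -- The weights are nonzero because `x` is off `K`: the dependent triple `y`, `z`, `x`
          -- consists of distinct points.
          ... | no  c₁≢c₂ with coefficients≢0 {c = 1#} (proj₁ K-cap y Ky) (proj₁ K-cap z Kz) nx y≢z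
                  (λ z≡x → ¬Kx (subst K z≡x Kz)) (λ y≡x → ¬Kx (subst K y≡x Ky))
                  (λ (_ , _ , 1≡0) → 0≢1 (sym 1≡0)) (x⊕[y⊕1·[x⊕y]]≡0 (c₁ · y) (c₂ · z))
          ...   | c₁≢0 , c₂≢0 , _ = contradiction cap
                  (joins-secant Ky Kz c₁≢0 c₂≢0 c₁≢c₂ (λ y≡z → contradiction y≡z y≢z) refl)

      split-normalized : ∀ {n x₀ x₁ x₂} {v : Vec Carrier n} → Normalized (x₀ ∷ x₁ ∷ x₂ ∷ v) →
        Normalized (x₀ ∷ x₁ ∷ x₂ ∷ []) ⊎ (x₀ ≡ 0# × x₁ ≡ 0# × x₂ ≡ 0# × Normalized v)
      split-normalized (inj₁ p)                                  = inj₁ (inj₁ p)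
      split-normalized (inj₂ (p , inj₁ q))                       = inj₁ (inj₂ (p , inj₁ q))
      split-normalized (inj₂ (p , inj₂ (q , inj₁ r)))            = inj₁ (inj₂ (p , inj₂ (q , inj₁ r)))
      split-normalized (inj₂ (p , inj₂ (q , inj₂ (r , nv))))     = inj₂ (p , q , r , nv)

      X-complete : ∀ s P → Normalized P → ¬ X s P → ¬ IsCap (λ x → X s x ⊎ x ≡ P)
      X-complete zero P nP ¬XP cap = K-complete P nP (¬XP ∘ K⇒X₀)
        (cap-⊆ (λ { x (inj₁ Kx) → inj₁ (K⇒X₀ Kx) ; x (inj₂ x≡P) → inj₂ x≡P }) cap)
      X-complete (suc s) (x₀ ∷ x₁ ∷ x₂ ∷ v) nP ¬XP cap with split-normalized {v = v} nP
      ... | inj₂ (refl , refl , refl , nv) =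
        -- Here `P` is `D (0# ∷ v)`.
        complete-D (X-complete s (0# ∷ v) (inj₂ (refl , nv)) (¬XP ∘ lift)) (inj₂ (refl , nv)) cap
      ... | inj₁ nx = above-nonSumPoint {x = x₀ ∷ x₁ ∷ x₂ ∷ []} ¬XP nx
          (λ Kx → above-arc {x = x₀ ∷ x₁ ∷ x₂ ∷ []} ¬XP Kx cap) above-sumPoint cap
        where
        above-sumPoint : ¬ IsSumPoint K (x₀ ∷ x₁ ∷ x₂ ∷ [])
        -- The plane part is `Q₀`, so `P` is `D (1# ∷ v)`.
        above-sumPoint Sx with refl ← sumPoint-unique _ Sx =
          complete-D (X-complete s (1# ∷ v) (inj₁ refl) (¬XP ∘ lift)) (inj₁ refl) cap

    -- The size of the cap

    vectors-size : ∀ n → HasSize {Vec Carrier n} (λ _ → ⊤) (order ^ n)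
    vectors-size zero    = [] ∷ [] , [] ∷ [] , (λ { [] → mk⇔ (λ _ → tt) (λ _ → here refl) }) , refl
    vectors-size (suc n) = size-resp-⇔
      (λ { (x ∷ xs) → mk⇔ (λ _ → tt) (λ _ → x , xs , tt , tt , refl) })
      (size-image₂ _∷_ Vec.∷-injective
        (elements , elements-unique , (λ x → mk⇔ (λ _ → tt) (λ _ → elements-complete x)) , refl)
        (vectors-size n))

    -- The factor `⊤` gives the predicate the shape produced by `size-image₂`.
    JoinPoint : ∀ s → Vec Carrier (3 ℕ.+ double s) → Set
    JoinPoint s v = ∃[ x ] ∃[ a ] K x × ⊤ × v ≡ x ++ withSquares {s} a

    joins-size : ∀ {k} → HasSize K k → ∀ s → HasSize (JoinPoint s) (k ℕ.* order ^ s)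
    joins-size K-size s = size-image₂ (λ x a → x ++ withSquares a) join-injective K-size (vectors-size s)
      where
      join-injective : ∀ {w x : Vec Carrier 3} {a b : Vec Carrier s} →
        w ++ withSquares a ≡ x ++ withSquares b → w ≡ x × a ≡ b
      join-injective {w} {x} eq with Vec.++-injective w x eq
      ... | w≡x , a≡b = w≡x , withSquares-injective a≡b

    -- A lift starts with 0 and repeats its next entry, whereas `e₁` and `e₂`, the only points of
    -- `K` with first coordinate 0, have different second and third coordinates.
    joins-lifts-disjoint : ∀ {s} v → JoinPoint (suc s) v → ¬ (∃[ u ] X s u × v ≡ D u)
    joins-lifts-disjoint _ (x₀ ∷ x₁ ∷ x₂ ∷ [] , a , Kx , _ , refl) (u₀ ∷ us , _ , eq)
      with x₁≡x₂ ← trans (∷-injectiveˡ (∷-injectiveʳ eq)) (sym (∷-injectiveˡ (∷-injectiveʳ (∷-injectiveʳ eq))))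
      with K∞ _ Kx (∷-injectiveˡ eq)
    ... | inj₁ refl = 0≢1 (sym x₁≡x₂)
    ... | inj₂ refl = 0≢1 x₁≡x₂

    X-size : ∀ {k} → HasSize K k → ∀ s → HasSize (X s) (k ℕ.* geomSum order s)
    X-size K-size zero = size-resp-⇔
      (λ v → mk⇔ (λ { (_ , a , Kx , _ , refl) → join Kx a }) (λ { (join Kx a) → _ , a , Kx , tt , refl }))
      (joins-size K-size zero)
    X-size {k} K-size (suc s) = subst (HasSize (X (suc s))) (sym (ℕ.*-distribˡ-+ k (order ^ suc s) (geomSum order s)))
      (size-resp-⇔ (λ v → mk⇔ ⇒ ⇐)
        (size-⊎ joins-lifts-disjoint (joins-size K-size (suc s)) (size-image D D-injective (X-size K-size s))))
      where
      ⇒ : ∀ {v} → JoinPoint (suc s) v ⊎ (∃[ u ] X s u × v ≡ D u) → X (suc s) v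
      ⇒ (inj₁ (_ , a , Kx , _ , refl)) = join Kx a
      ⇒ (inj₂ (_ , Xu , refl))         = lift Xu
      ⇐ : ∀ {v} → X (suc s) v → JoinPoint (suc s) v ⊎ (∃[ u ] X s u × v ≡ D u)
      ⇐ (join Kx a) = inj₁ (_ , a , Kx , tt , refl)
      ⇐ (lift Xu)   = inj₂ (_ , Xu , refl)

-- The theorem, with the field shown to have more than two elements

theorem3p14 : (F : FiniteField) →
    let open FiniteField F
        open Geometry F
    in
    (e : ℕ) → order ≡ 2 ^ e →
    (s : ℕ) → 1 ≤ s →
    (K : PointSet 2) (k p : ℕ) →
    IsCompleteArc K k →
    UniqueSumPointWith K p →
    K e₁ → K e₂ →
    (∀ x → K x → head x ≡ 0# → x ≡ e₁ ⊎ x ≡ e₂) →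
    (k ∸ 2) ℕ.* p < order ∸ 1 →
    (∀ A a → S₁ K A → ¬ K (1# ∷ a ∷ (A * (a * a)) ∷ [])) →
    IsCompleteCap (𝒳 K s) × HasSize (𝒳 K s) (k ℕ.* geomSum order s)
theorem3p14 F e order≡2^e s _ K k p ((K-cap , K-complete) , K-size) (Q , Q-sum , Q-unique , Q-secants)
  Ke₁ Ke₂ K∞ small K-avoids =
  completeCap-resp (cong (2 ℕ.+_) (double≡+ s))
    (λ u v u≡v → mk⇔ (X⇒𝒳 (proj₁ K-cap) u≡v) (𝒳⇒X u u≡v))
    ((X-cap s , X-complete s) , X-size K-size s)
  where
  open FieldProperties F using (order≡2^e⇒1+1≡0)
  1+1≡0 = order≡2^e⇒1+1≡0 e order≡2^e
  open VectorProperties F 1+1≡0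
  open Construction F 1+1≡0 K
  open Cap K-cap Ke₁ Ke₂ K∞ K-avoids

  sumPoint-unique : ∀ P → IsSumPoint K P → P ≡ Q₀
  sumPoint-unique P P-sum = trans (Q-unique P P-sum) (sym (Q-unique Q₀ Q₀-sumPoint))

  -- As a point this is the affine origin; as a dual vector it is the line at infinity.
  O : Vec Carrier 3
  O = 1# ∷ 0# ∷ 0# ∷ []

  -- Without affine points of K, the point O would be a second sum-point.
  K⊈l∞ : ¬ (∀ x → K x → head x ≡ 0#)
  K⊈l∞ at∞ = 0≢1 (sym (∷-injectiveˡ (sumPoint-unique O O-sum)))
    where
    O-sum : IsSumPoint K O
    O-sum = inj₁ refl , (λ KO → 0≢1 (sym (at∞ O KO))) , equal
      where
      equal : ∀ P₁ P₂ c₁ c₂ → K P₁ → K P₂ → P₁ ≢ P₂ → O ≡ (c₁ · P₁) ⊕ (c₂ · P₂) → c₁ ≡ c₂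
      equal P₁@(_ ∷ _) P₂@(_ ∷ _) c₁ c₂ KP₁ KP₂ _ eq with refl ← at∞ P₁ KP₁ | refl ← at∞ P₂ KP₂ =
        contradiction (sym (trans (∷-injectiveˡ eq)
          (solve 2 (λ c₁ c₂ → c₁ :* con false :+ c₂ :* con false := con false) refl c₁ c₂))) 0≢1

  e₁≢e₂ : e₁ ≢ e₂
  e₁≢e₂ eq = 0≢1 (sym (∷-injectiveˡ (∷-injectiveʳ eq)))

  affine⇒3≤k : ∀ x → K x → head x ≢ 0# → 3 ≤ k
  affine⇒3≤k x Kx x₀≢0 = size-lower K-size
    ((e₁≢e₂ ∷ (λ { refl → x₀≢0 refl }) ∷ []) ∷ ((λ { refl → x₀≢0 refl }) ∷ []) ∷ [] ∷ [])
    (Ke₁ ∷ Ke₂ ∷ Kx ∷ [])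

  -- The line at infinity is a secant of `K` and passes through the sum-point.
  1≤p : 1 ≤ p
  1≤p = size-lower Q-secants ([] ∷ [])
    ((l∞-secant , subst (OnLine O) (Q-unique Q₀ Q₀-sumPoint) (l∞-equation 0# 1# 1#)) ∷ [])
    where
    l∞-equation : ∀ x₀ x₁ x₂ → dot O (x₀ ∷ x₁ ∷ x₂ ∷ []) ≡ x₀
    l∞-equation = solve 3 (λ x₀ x₁ x₂ →
      con true :* x₀ :+ (con false :* x₁ :+ (con false :* x₂ :+ con false)) := x₀) refl
    l∞-secant : IsSecant K O
    l∞-secant = inj₁ refl , e₁ ∷ e₂ ∷ [] , (e₁≢e₂ ∷ []) ∷ [] ∷ [] ,
      (λ x → mk⇔ ⇒ ⇐) , refl
      where
      ⇒ : ∀ {x} → x ∈ e₁ ∷ e₂ ∷ [] → K x × OnLine O x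
      ⇒ (here refl)         = Ke₁ , l∞-equation 0# 1# 0#
      ⇒ (there (here refl)) = Ke₂ , l∞-equation 0# 0# 1#
      ⇐ : ∀ {x} → K x × OnLine O x → x ∈ e₁ ∷ e₂ ∷ []
      ⇐ {x₀ ∷ x₁ ∷ x₂ ∷ []} (Kx , x∈l∞) with K∞ _ Kx (trans (sym (l∞-equation x₀ x₁ x₂)) x∈l∞)
      ... | inj₁ refl = here refl
      ... | inj₂ refl = there (here refl)

  -- Over two elements `small` would give (k - 2) p < 1. An affine point of `K` makes k at least 3,
  -- and p is at least 1, so `K` would lie at infinity, against `K⊈l∞`.
  ¬binary : ¬ (∀ c → c ≢ 0# → c ≡ 1#)
  ¬binary 0-or-1 = K⊈l∞ at∞
    where
    order≤2 : order ≤ 2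
    order≤2 = unique-⊆⇒length-≤ {ys = 0# ∷ 1# ∷ []} elements-unique λ {c} _ → member c
      where
      member : ∀ c → c ∈ 0# ∷ 1# ∷ []
      member c with c ≟ 0#
      ... | yes c≡0 = here c≡0
      ... | no  c≢0 = there (here (0-or-1 c c≢0))
    at∞ : ∀ x → K x → head x ≡ 0#
    at∞ x Kx with head x ≟ 0#
    ... | yes x₀≡0 = x₀≡0
    ... | no  x₀≢0 = contradiction
      (ℕ.≤-trans small (ℕ.∸-monoˡ-≤ 1 order≤2))
      (ℕ.≤⇒≯ (ℕ.*-mono-≤ (ℕ.∸-monoˡ-≤ 2 (affine⇒3≤k x Kx x₀≢0)) 1≤p))

  open Complete K-complete sumPoint-unique ¬binary
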